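{- For all integers $n\ge1$ and $m\ge0$, the number of matchings on $[2n]$ that avoid the pattern $12312$ and have exactly $m$ crossings equals $$\sum_{i=n}^{2n-1}\frac{(-1)^{n+m+i}}{i}\binom{i}{n}\binom{3n}{i+1+n}\binom{i-n}{m}.$$
   Context: A matching on $[2n]$ is a partition of $[2n]$ into $n$ blocks of size two (edges), an edge written $(i,j)$ with $i<j$. Two edges $(i,j),(i',j')$ cross if $i<i'<j<j'$ or $i'<i<j'<j$; the number of crossings of a matching is the number of unordered pairs of its edges that cross. The canonical sequential form of a matching with $n$ edges is the word of length $2n$ obtained by labeling edges $1,\dots,n$ in increasing order of initial points and writing at each position the label of the edge containing it. Words $a_1\cdots a_k$, $b_1\cdots b_k$ are order-isomorphic if $a_i<a_j\iff b_i<b_j$ for all $i,j$. A matching contains a pattern $\tau$ if its canonical sequential form has a subsequence order-isomorphic to $\tau$, and avoids $\tau$ otherwise. -}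

module Defs where

open import Data.Nat as ℕ using (ℕ; zero; suc; _+_; _*_; _∸_)
import Data.Nat.Properties as ℕP
open import Data.Nat.Combinatorics using (_C_)
open import Data.Fin as Fin using (Fin; toℕ)
import Data.Fin.Properties as FinP
open import Data.Vec as Vec using (Vec; []; _∷_; lookup)
open import Data.List as List using (List; []; _∷_; length; filter; map; concatMap; allFin; upTo; cartesianProduct; foldr)
open import Data.List.Relation.Unary.Any using (Any; any?)
open import Data.Product using (_×_; _,_; proj₁; proj₂)
open import Data.Integer as ℤ using (ℤ; +_; -[1+_])
open import Data.Rational as ℚ using (ℚ; 0ℚ)
open import Relation.Nullary using (¬_; Dec; ¬?)
open import Relation.Nullary.Decidable using (_×-dec_; _→-dec_)
open import Relation.Binary.PropositionalEquality using (_≡_; _≢_)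

allVecs : (N k : ℕ) → List (Vec (Fin N) k)
allVecs N zero    = [] ∷ []
allVecs N (suc k) = concatMap (λ x → map (x ∷_) (allVecs N k)) (allFin N)

-- Matchings on [2n]: positions are Fin (2 * n) (0-based); a matching is
-- encoded by its partner map v (v i = the other endpoint of the edge of i),
-- i.e. a fixed-point-free involution.  Such maps are in bijection with the
-- partitions of [2n] into blocks of size two.

IsMatching : ∀ {N} → Vec (Fin N) N → Set
IsMatching {N} v = ∀ (i : Fin N) → (lookup v i ≢ i) × (lookup v (lookup v i) ≡ i)

isMatching? : ∀ {N} (v : Vec (Fin N) N) → Dec (IsMatching v)
isMatching? v = FinP.all? (λ i → ¬? (lookup v i FinP.≟ i) ×-dec (lookup v (lookup v i) FinP.≟ i))

-- Number of crossings: pairs of edges (i, v i), (j, v j) with i < j < v i < v j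
-- (each unordered crossing pair counted once, ordered by initial points).
Crosses : ∀ {N} → Vec (Fin N) N → Fin N × Fin N → Set
Crosses v (i , j) = (i Fin.< j) × (j Fin.< lookup v i) × (lookup v i Fin.< lookup v j)

crossings : ∀ {N} → Vec (Fin N) N → ℕ
crossings {N} v =
  length (filter (λ p → (proj₁ p Fin.<? proj₂ p)
                   ×-dec (proj₂ p Fin.<? lookup v (proj₁ p))
                   ×-dec (lookup v (proj₁ p) Fin.<? lookup v (proj₂ p)))
                 (cartesianProduct (allFin N) (allFin N)))

-- Canonical sequential form: edges labelled 1,2,… in increasing order of
-- initial points (the initial point of the edge of p is min(p, v p)); the
-- label at p is the number of initial points q (q < v q) with q ≤ min(p, v p).
label : ∀ {N} → Vec (Fin N) N → Fin N → ℕ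
label {N} v p =
  length (filter (λ q → (q Fin.≤? p) ×-dec (q Fin.≤? lookup v p) ×-dec (q Fin.<? lookup v q))
                 (allFin N))

IsOccurrence : ∀ {N k} → (Fin N → ℕ) → Vec ℕ k → Vec (Fin N) k → Set
IsOccurrence {N} {k} w τ s =
  ∀ (a b : Fin k) →
    ((a Fin.< b → lookup s a Fin.< lookup s b)
    × (lookup τ a ℕ.< lookup τ b → w (lookup s a) ℕ.< w (lookup s b))
    × (w (lookup s a) ℕ.< w (lookup s b) → lookup τ a ℕ.< lookup τ b))

isOccurrence? : ∀ {N k} (w : Fin N → ℕ) (τ : Vec ℕ k) (s : Vec (Fin N) k) → Dec (IsOccurrence w τ s)
isOccurrence? w τ s = FinP.all? λ a → FinP.all? λ b →
     ((a Fin.<? b) →-dec (lookup s a Fin.<? lookup s b))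
  ×-dec ((lookup τ a ℕ.<? lookup τ b) →-dec (w (lookup s a) ℕ.<? w (lookup s b)))
  ×-dec ((w (lookup s a) ℕ.<? w (lookup s b)) →-dec (lookup τ a ℕ.<? lookup τ b))

Contains : ∀ {N k} → (Fin N → ℕ) → Vec ℕ k → Set
Contains {N} {k} w τ = Any (IsOccurrence w τ) (allVecs N k)

contains? : ∀ {N k} (w : Fin N → ℕ) (τ : Vec ℕ k) → Dec (Contains w τ)
contains? {N} {k} w τ = any? (isOccurrence? w τ) (allVecs N k)

Avoids : ∀ {N k} → Vec (Fin N) N → Vec ℕ k → Set
Avoids v τ = ¬ Contains (label v) τ

avoids? : ∀ {N k} (v : Vec (Fin N) N) (τ : Vec ℕ k) → Dec (Avoids v τ)
avoids? v τ = ¬? (contains? (label v) τ)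

p12312 : Vec ℕ 5
p12312 = 1 ∷ 2 ∷ 3 ∷ 1 ∷ 2 ∷ []

count12312 : ℕ → ℕ → ℕ
count12312 n m =
  length (filter (λ v → isMatching? v ×-dec avoids? v p12312 ×-dec (crossings v ℕ.≟ m))
                 (allVecs (2 * n) (2 * n)))

-- z / d; only ever used with d ≥ 1 (the d = 0 clause is a dummy).
_÷_ : ℤ → ℕ → ℚ
z ÷ zero  = 0ℚ
z ÷ suc d = z ℚ./ suc d

sumℚ : List ℚ → ℚ
sumℚ = foldr ℚ._+_ 0ℚ

term : ℕ → ℕ → ℕ → ℚ
term n m i = ((-[1+ 0 ] ℤ.^ (n + m + i)) ℤ.* (+ ((i C n) * ((3 * n) C (i + 1 + n)) * ((i ∸ n) C m)))) ÷ i

rhs : ℕ → ℕ → ℚ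
rhs n m = sumℚ (map (λ k → term n m (n + k)) (upTo n))

{-# OPTIONS --safe #-}

-- A matching avoids 12312 iff no edge opens between the opening of the second and the closing of the
-- first edge of a crossing. Reading such a matching from left to right, a closer must therefore
-- belong to the last of the open edges or, if that edge was the last one to be opened, to the last
-- but one; the latter case produces exactly one crossing. So the matchings are encoded by lattice
-- paths, whose height is the number of open edges. Marking edges by x and crossings by q = 1 + t, the
-- generating functions of the completions of a partial matching satisfy linear recurrences in the
-- height. With x = z / φ(z) and φ = (1 + z)³ / (1 - t z) these are solved by explicit series in z, the
-- one at height 0 being 1 + z, and Lagrange inversion gives n [xⁿ] z = [zⁿ⁻¹] φⁿ.
module Submission where

open import Defs
open import Algebra using (CommutativeRing)
import Algebra.Properties.CommutativeMonoid.Mult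
import Algebra.Properties.CommutativeSemigroup
import Algebra.Properties.CommutativeSemiring.Exp
import Algebra.Properties.Group
import Algebra.Properties.Ring
import Algebra.Properties.Semiring.Mult
import Algebra.Solver.Ring.NaturalCoefficients.Default
open import Data.Nat as ℕ using (ℕ; zero; suc; _∸_; _≤_; s≤s; z≤n)
import Data.Nat.Properties as ℕP
open import Data.Nat.Combinatorics using (_C_; nCk≡nC[n∸k]; nCk+nC[k+1]≡[n+1]C[k+1]; nCn≡1; k>n⇒nCk≡0)
open import Data.Product using (_,_; proj₁; proj₂; Σ-syntax; ∃-syntax)
open import Function using (_∘_)
import Relation.Binary.PropositionalEquality as ≡
import Relation.Binary.Reasoning.Setoid

-- Power series and Lagrange inversion

-- The parametrisation comes from the kernel method. Eliminating one family of counts leaves a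
-- linear recurrence in the height with characteristic equation x y³ = (y - 1)(y - q). Two of its
-- roots are finite at x = 0, where they equal 1 and q; the third has a pole there. Writing the
-- third as (1 + z) / z gives x = z (1 - t z) / (1 + z)³, which is where φ comes from. The other two
-- roots then belong to a quadratic whose coefficients are power series in z, so the generating
-- functions at all heights satisfy a recurrence of order two and no roots have to be extracted.
-- None of this has to be derived formally: the recurrences determine the counts, so it is enough to
-- check that the proposed series satisfy them. Nor is the inverse series of z / φ constructed. A
-- linear functional standing for [xⁿ] takes its place, under which a factor z / φ becomes a shift
-- of n. The signs of the formula come from t = q - 1: the expansion in powers of t has nonnegative
-- coefficients, and extracting a power of q makes the sum alternate.

module PowerSeries {c ℓ} (R : CommutativeRing c ℓ) where
  open CommutativeRing R hiding (zero)
  open Algebra.Properties.CommutativeSemigroup +-commutativeSemigroup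
    using () renaming (interchange to +-interchange; x∙yz≈y∙xz to x+[y+z]≈y+[x+z])
  open Algebra.Properties.CommutativeMonoid.Mult +-commutativeMonoid
    using (_×_; ×-congʳ; ×-distrib-+)
  open Algebra.Properties.Semiring.Mult semiring using (×-comm-*)
  open Relation.Binary.Reasoning.Setoid setoid

  Series : Set c
  Series = ℕ → Carrier

  -- Summing from the front makes `(f ⊛ g) (suc k)` unfold to `f 0 * g (suc k) + ((f ∘ suc) ⊛ g) k`,
  -- so the laws of `⊛` follow by induction on the coefficient with `f` generalised.
  Σ≤ : ℕ → (ℕ → Carrier) → Carrier
  Σ≤ zero    f = f 0
  Σ≤ (suc k) f = f 0 + Σ≤ k (f ∘ suc)

  Σ≤-cong : ∀ k {f g : ℕ → Carrier} → (∀ j → f j ≈ g j) → Σ≤ k f ≈ Σ≤ k g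
  Σ≤-cong zero    f≈g = f≈g 0
  Σ≤-cong (suc k) f≈g = +-cong (f≈g 0) (Σ≤-cong k (f≈g ∘ suc))

  Σ≤-+ : ∀ k (f g : ℕ → Carrier) → Σ≤ k (λ j → f j + g j) ≈ Σ≤ k f + Σ≤ k g
  Σ≤-+ zero    f g = refl
  Σ≤-+ (suc k) f g = trans (+-congˡ (Σ≤-+ k (f ∘ suc) (g ∘ suc))) (+-interchange _ _ _ _)

  Σ≤-* : ∀ k a (f : ℕ → Carrier) → Σ≤ k (λ j → a * f j) ≈ a * Σ≤ k f
  Σ≤-* zero    a f = refl
  Σ≤-* (suc k) a f = trans (+-congˡ (Σ≤-* k a (f ∘ suc))) (sym (distribˡ _ _ _))

  infixl 7 _⊛_
  _⊛_ : Series → Series → Series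
  (f ⊛ g) k = Σ≤ k (λ j → f j * g (k ∸ j))

  const : Carrier → Series
  const a zero    = a
  const a (suc k) = 0#

  z : Series
  z zero    = 0#
  z (suc k) = const 1# k

  ⊛-cong : ∀ {f f′ g g′} → (∀ k → f k ≈ f′ k) → (∀ k → g k ≈ g′ k) → ∀ k → (f ⊛ g) k ≈ (f′ ⊛ g′) k
  ⊛-cong f≈ g≈ k = Σ≤-cong k (λ j → *-cong (f≈ j) (g≈ (k ∸ j)))

  ⊛-distribʳ : ∀ h f g k → ((λ j → f j + g j) ⊛ h) k ≈ (f ⊛ h) k + (g ⊛ h) k
  ⊛-distribʳ h f g k = trans (Σ≤-cong k (λ j → distribʳ (h (k ∸ j)) (f j) (g j)))
                             (Σ≤-+ k _ _)

  scale-⊛ : ∀ a f g k → ((λ j → a * f j) ⊛ g) k ≈ a * (f ⊛ g) k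
  scale-⊛ a f g k = trans (Σ≤-cong k (λ j → *-assoc a (f j) (g (k ∸ j)))) (Σ≤-* k a _)

  0-⊛ : ∀ g k → ((λ _ → 0#) ⊛ g) k ≈ 0#
  0-⊛ g k = trans (Σ≤-* k 0# (λ j → g (k ∸ j))) (zeroˡ _)

  const-⊛ : ∀ a f k → (const a ⊛ f) k ≈ a * f k
  const-⊛ a f zero    = refl
  const-⊛ a f (suc k) = trans (+-congˡ (0-⊛ f k)) (+-identityʳ _)

  -- Peels off the last summand where the definition peels off the first; matching the two gives
  -- commutativity.
  ⊛-lastʳ : ∀ f g k → (f ⊛ g) (suc k) ≈ f (suc k) * g 0 + (f ⊛ (g ∘ suc)) k
  ⊛-lastʳ f g zero    = +-comm _ _
  ⊛-lastʳ f g (suc k) = trans (+-congˡ (⊛-lastʳ (f ∘ suc) g k)) (x+[y+z]≈y+[x+z] _ _ _)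

  ⊛-comm : ∀ f g k → (f ⊛ g) k ≈ (g ⊛ f) k
  ⊛-comm f g zero    = *-comm _ _
  ⊛-comm f g (suc k) = trans (+-cong (*-comm _ _) (⊛-comm (f ∘ suc) g k)) (sym (⊛-lastʳ g f k))

  ⊛-assoc : ∀ f g h k → ((f ⊛ g) ⊛ h) k ≈ (f ⊛ (g ⊛ h)) k
  ⊛-assoc f g h zero    = *-assoc _ _ _
  ⊛-assoc f g h (suc k) = begin
    f 0 * g 0 * h (suc k) + ((λ j → f 0 * g (suc j) + ((f ∘ suc) ⊛ g) j) ⊛ h) k
      ≈⟨ +-cong (*-assoc _ _ _)
           (trans (⊛-distribʳ h _ _ k) (+-cong (scale-⊛ (f 0) (g ∘ suc) h k) (⊛-assoc (f ∘ suc) g h k))) ⟩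
    f 0 * (g 0 * h (suc k)) + (f 0 * ((g ∘ suc) ⊛ h) k + ((f ∘ suc) ⊛ (g ⊛ h)) k)
      ≈⟨ +-assoc _ _ _ ⟨
    (f 0 * (g 0 * h (suc k)) + f 0 * ((g ∘ suc) ⊛ h) k) + ((f ∘ suc) ⊛ (g ⊛ h)) k
      ≈⟨ +-congʳ (distribˡ _ _ _) ⟨
    f 0 * (g ⊛ h) (suc k) + ((f ∘ suc) ⊛ (g ⊛ h)) k ∎

  seriesRing : CommutativeRing c ℓ
  seriesRing = record
    { Carrier = Series
    ; _≈_ = λ f g → ∀ k → f k ≈ g k
    ; _+_ = λ f g k → f k + g k
    ; _*_ = _⊛_
    ; -_  = λ f k → - f k
    ; 0#  = λ _ → 0#
    ; 1#  = const 1#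
    ; isCommutativeRing = record
      { isRing = record
        { +-isAbelianGroup = record
          { isGroup = record
            { isMonoid = record
              { isSemigroup = record
                { isMagma = record
                  { isEquivalence = record
                    { refl = λ _ → refl
                    ; sym = λ p k → sym (p k)
                    ; trans = λ p q k → trans (p k) (q k) }
                  ; ∙-cong = λ p q k → +-cong (p k) (q k) }
                ; assoc = λ f g h k → +-assoc _ _ _ }
              ; identity = (λ f k → +-identityˡ _) , (λ f k → +-identityʳ _) }
            ; inverse = (λ f k → -‿inverseˡ _) , (λ f k → -‿inverseʳ _)
            ; ⁻¹-cong = λ p k → -‿cong (p k) }
          ; comm = λ f g k → +-comm _ _ }
        ; *-cong = ⊛-cong
        ; *-assoc = ⊛-assoc
        ; *-identity = 1-⊛ , λ f k → trans (⊛-comm f _ k) (1-⊛ f k)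
        ; distrib = (λ f g h k → trans (⊛-comm f _ k) (trans (⊛-distribʳ f g h k)
                                        (+-cong (⊛-comm g f k) (⊛-comm h f k))))
                  , ⊛-distribʳ }
      ; *-comm = ⊛-comm } }
    where
    1-⊛ : ∀ f k → (const 1# ⊛ f) k ≈ f k
    1-⊛ f k = trans (const-⊛ 1# f k) (*-identityˡ _)

  z-⊛ : ∀ f k → (z ⊛ f) (suc k) ≈ f k
  z-⊛ f k = trans (+-cong (zeroˡ _) (CommutativeRing.*-identityˡ seriesRing f k)) (+-identityˡ _)

  -- The Euler operator z d/dz, which avoids index shifts.
  D : Series → Series
  D f k = k × f k

  -- `D f (suc j)` unfolds to `f′ j + D f′ j`; the extra `f′` absorbs the one copy of `(f′ ⊛ g) k`
  -- by which the multiple `suc k` exceeds the induction hypothesis.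
  D-⊛ : ∀ f g k → D (f ⊛ g) k ≈ (D f ⊛ g) k + (f ⊛ D g) k
  D-⊛ f g zero    = sym (trans (+-cong (zeroˡ _) (zeroʳ _)) (+-identityˡ _))
  D-⊛ f g (suc k) = begin
    suc k × (f 0 * g (suc k) + (f′ ⊛ g) k)
      ≈⟨ ×-distrib-+ _ _ (suc k) ⟩
    suc k × (f 0 * g (suc k)) + ((f′ ⊛ g) k + k × (f′ ⊛ g) k)
      ≈⟨ +-cong (sym (×-comm-* (suc k) _ _)) (+-congˡ (D-⊛ f′ g k)) ⟩
    f 0 * D g (suc k) + ((f′ ⊛ g) k + ((D f′ ⊛ g) k + (f′ ⊛ D g) k))
      ≈⟨ +-congˡ (sym (+-assoc _ _ _)) ⟩
    f 0 * D g (suc k) + ((f′ ⊛ g) k + (D f′ ⊛ g) k + (f′ ⊛ D g) k)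
      ≈⟨ x+[y+z]≈y+[x+z] _ _ _ ⟩
    ((f′ ⊛ g) k + (D f′ ⊛ g) k) + (f ⊛ D g) (suc k)
      ≈⟨ +-congʳ (⊛-distribʳ g f′ (D f′) k) ⟨
    (((λ j → f′ j + D f′ j) ⊛ g) k) + (f ⊛ D g) (suc k)
      ≈⟨ +-congʳ (trans (+-congʳ (zeroˡ _)) (+-identityˡ _)) ⟨
    (D f ⊛ g) (suc k) + (f ⊛ D g) (suc k) ∎
    where
    f′ : Series
    f′ = f ∘ suc

-- With x = z / φ, the series N h and φ T h are the generating functions in x of the completions of a
-- partial matching with h, respectively suc h, open edges; in the latter case the last point read is
-- an opener, or a closer that was not on top, so that the next closer may cross.
module Kernel {c ℓ} (K : CommutativeRing c ℓ) where
  open CommutativeRing K hiding (zero)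
  open Algebra.Properties.Group +-group using () renaming (∙-cancelʳ to +-cancelʳ)
  open Relation.Binary.Reasoning.Setoid setoid
  private
    module Solver = Algebra.Solver.Ring.NaturalCoefficients.Default commutativeSemiring
  open Solver using (solve; _:=_; _:+_; _:*_; con)

  -- `s` stands for 1 / (1 - t z) and is known only through its equation.
  module _ (z t s : Carrier) (s-rec : s ≈ 1# + t * z * s) where

    q p φ : Carrier
    q = 1# + t
    p = 1# + z
    φ = p * p * p * s

    -- The cubic z y³ = φ (y - 1)(y - q) has the root p / z, and dividing it out leaves y² = s (p (1
    -- + q + z) y - q p²), the characteristic equation of this recurrence. The value 1 at height 0
    -- makes z the generating function of the nonempty avoiding matchings; the value at 1 is then
    -- forced by φ T 0 = N 1.
    T : ℕ → Carrier
    T 0 = 1#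
    T 1 = s * (p * (1# + q + z))
    T (suc (suc h)) = s * (p * (1# + q + z) * T (suc h) - q * (p * p) * T h)

    N : ℕ → Carrier
    N zero    = 1# + z
    N (suc h) = N h + z * T (suc h)

    private
      -- Multiplied by `p`, this compares the coefficients of y² in the factorisation of z y³ - φ (y
      -- - 1)(y - q) into z y - p and the quadratic behind `T`.
      s-rec′ : p * p * s ≈ 1# + z * s * (1# + q + z)
      s-rec′ = begin
        p * p * s
          ≈⟨ solve 2 (λ z s → (con 1 :+ z) :* (con 1 :+ z) :* s
                := s :+ z :* s :* (con 2 :+ z)) refl z s ⟩
        s + z * s * (1# + 1# + z)
          ≈⟨ +-congʳ s-rec ⟩
        1# + t * z * s + z * s * (1# + 1# + z)
          ≈⟨ solve 3 (λ z s t → con 1 :+ t :* z :* s :+ z :* s :* (con 2 :+ z)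
                := con 1 :+ z :* s :* (con 1 :+ (con 1 :+ t) :+ z)) refl z s t ⟩
        1# + z * s * (1# + q + z) ∎

      T-rec : ∀ h → T (suc (suc h)) + s * (q * (p * p) * T h) ≈ s * (p * (1# + q + z) * T (suc h))
      T-rec h = begin
        s * (A - B) + s * B  ≈⟨ distribˡ s _ _ ⟨
        s * (A - B + B)      ≈⟨ *-congˡ (trans (+-assoc _ _ _) (trans (+-congˡ (-‿inverseˡ B)) (+-identityʳ A))) ⟩
        s * A                ∎
        where
        A B : Carrier
        A = p * (1# + q + z) * T (suc h)
        B = q * (p * p) * T h

      pT-split : ∀ x → φ * x ≈ p * x + z * (s * (p * (1# + q + z) * x))
      pT-split x = begin
        φ * x                                ≈⟨ solve 3 (λ p s x → p :* p :* p :* s :* x := p :* x :* (p :* p :* s)) refl p s x ⟩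
        p * x * (p * p * s)                  ≈⟨ *-congˡ s-rec′ ⟩
        p * x * (1# + z * s * (1# + q + z))  ≈⟨ solve 5 (λ p x z s u → p :* x :* (con 1 :+ z :* s :* u)
                                                   := p :* x :+ z :* (s :* (p :* u :* x))) refl p x z s (1# + q + z) ⟩
        p * x + z * (s * (p * (1# + q + z) * x)) ∎

    φT-zero : φ * T 0 ≈ N 1
    φT-zero = trans (pT-split 1#) (+-cong (*-identityʳ _) (*-congˡ (*-congˡ (*-identityʳ _))))

    -- The inductive step combines z times `T-rec (suc h)` with p times `T-rec h`.
    φT-suc : ∀ h → φ * T (suc h) ≈ N (suc (suc h)) + q * (φ * T h)
    -- The solver works in commutative semirings, so multiples of the terms subtracted in `T` are
    -- added on both sides and cancelled in the end.
    φT-suc zero = +-cancelʳ (z * (s * (q * (p * p)))) _ _ (begin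
      φ * T 1 + z * (s * (q * (p * p)))
        ≈⟨ +-congʳ (pT-split (T 1)) ⟩
      p * T 1 + z * (s * (p * (1# + q + z) * T 1)) + z * (s * (q * (p * p)))
        ≈⟨ +-congʳ (+-congˡ (*-congˡ (T-rec 0))) ⟨
      p * T 1 + z * (T 2 + s * (q * (p * p) * 1#)) + z * (s * (q * (p * p)))
        ≈⟨ solve 4 (λ q z s T2 → let p = con 1 :+ z in
              p :* (s :* (p :* (con 1 :+ q :+ z))) :+ z :* (T2 :+ s :* (q :* (p :* p) :* con 1)) :+ z :* (s :* (q :* (p :* p)))
           := p :* (p :* p :* s) :+ z :* T2 :+ q :* (p :* p :* p :* s :* con 1) :+ z :* (s :* (q :* (p :* p))))
           refl q z s (T 2) ⟩
      p * (p * p * s) + z * T 2 + q * (φ * 1#) + z * (s * (q * (p * p)))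
        ≈⟨ +-congʳ (+-congʳ (+-congʳ (trans eq φT-zero))) ⟩
      N 2 + q * (φ * T 0) + z * (s * (q * (p * p))) ∎)
      where
      eq : p * (p * p * s) ≈ φ * 1#
      eq = solve 2 (λ p s → p :* (p :* p :* s) := p :* p :* p :* s :* con 1) refl p s
    φT-suc (suc h) = +-cancelʳ (z * (s * (q * (p * p) * T1)) + p * (s * (q * (p * p) * T0))) _ _ (begin
      φ * T2 + (z * (s * (q * (p * p) * T1)) + p * (s * (q * (p * p) * T0)))
        ≈⟨ +-congʳ (pT-split T2) ⟩
      p * T2 + z * (s * (p * (1# + q + z) * T2)) + (z * (s * (q * (p * p) * T1)) + p * (s * (q * (p * p) * T0)))
        ≈⟨ +-congʳ (+-congˡ (*-congˡ (T-rec (suc h)))) ⟨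
      p * T2 + z * (T3 + s * (q * (p * p) * T1)) + (z * (s * (q * (p * p) * T1)) + p * (s * (q * (p * p) * T0)))
        ≈⟨ solve 6 (λ p T2 T3 z a b → p :* T2 :+ z :* (T3 :+ a) :+ (z :* a :+ p :* b)
             := p :* (T2 :+ b) :+ (z :* T3 :+ (z :* a :+ z :* a))) refl p T2 T3 z _ _ ⟩
      p * (T2 + s * (q * (p * p) * T0)) + (z * T3 + (z * (s * (q * (p * p) * T1)) + z * (s * (q * (p * p) * T1))))
        ≈⟨ +-congʳ (*-congˡ (T-rec h)) ⟩
      p * (s * (p * (1# + q + z) * T1)) + (z * T3 + (z * (s * (q * (p * p) * T1)) + z * (s * (q * (p * p) * T1))))
        ≈⟨ solve 5 (λ q z s T1 T3 → let p = con 1 :+ z ; a = s :* (q :* (p :* p) :* T1) in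
              p :* (s :* (p :* (con 1 :+ q :+ z) :* T1)) :+ (z :* T3 :+ (z :* a :+ z :* a))
           := (p :* p :* p :* s) :* T1 :+ z :* T3 :+ q :* ((p :* p :* p :* s) :* T1) :+ z :* a) refl q z s T1 T3 ⟩
      φ * T1 + z * T3 + q * (φ * T1) + z * (s * (q * (p * p) * T1))
        ≈⟨ +-congʳ (+-congʳ (+-congʳ (φT-suc h))) ⟩
      N (suc (suc h)) + q * (φ * T0) + z * T3 + q * (φ * T1) + z * (s * (q * (p * p) * T1))
        ≈⟨ solve 9 (λ N q p s T0 z T3 F a →
               N :+ q :* (p :* p :* p :* s :* T0) :+ z :* T3 :+ q :* F :+ a
            := N :+ z :* T3 :+ q :* F :+ (a :+ p :* (s :* (q :* (p :* p) :* T0)))) refl _ q p s T0 z T3 _ _ ⟩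
      N (suc (suc (suc h))) + q * (φ * T1) + (z * (s * (q * (p * p) * T1)) + p * (s * (q * (p * p) * T0))) ∎)
      where
      T0 T1 T2 T3 : Carrier
      T0 = T h
      T1 = T (suc h)
      T2 = T (suc (suc h))
      T3 = T (suc (suc (suc h)))

-- The functional of Lagrange inversion

module Lagrange {c ℓ} (R : CommutativeRing c ℓ) (t : CommutativeRing.Carrier R) where
  open CommutativeRing R hiding (zero)
  open PowerSeries R
  open Algebra.Properties.Group +-group using () renaming (∙-cancelʳ to +-cancelʳ)
  open Algebra.Properties.CommutativeMonoid.Mult +-commutativeMonoid
    using (_×_; ×-congʳ; ×-congˡ; ×-distrib-+; ×-homo-+; ×-homo-1; ×-assocˡ)
  open Algebra.Properties.Semiring.Mult semiring using (×-comm-*; ×-assoc-*)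
  open Algebra.Properties.CommutativeSemiring.Exp commutativeSemiring using (_^_)
  open Relation.Binary.Reasoning.Setoid setoid

  private
    module K = CommutativeRing seriesRing
    module KE = Algebra.Properties.CommutativeSemiring.Exp K.commutativeSemiring

  geometric : Series
  geometric k = t ^ k

  geometric-rec : geometric K.≈ K.1# K.+ const t ⊛ z ⊛ geometric
  geometric-rec zero    = sym (trans (+-congˡ (trans (*-congʳ (zeroʳ t)) (zeroˡ _))) (+-identityʳ 1#))
  geometric-rec (suc k) = sym (begin
    0# + (const t ⊛ z ⊛ geometric) (suc k)    ≈⟨ +-identityˡ _ ⟩
    (const t ⊛ z ⊛ geometric) (suc k)         ≈⟨ ⊛-assoc (const t) z geometric (suc k) ⟩
    (const t ⊛ (z ⊛ geometric)) (suc k)       ≈⟨ const-⊛ t (z ⊛ geometric) (suc k) ⟩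
    t * (z ⊛ geometric) (suc k)               ≈⟨ *-congˡ (z-⊛ geometric k) ⟩
    t * t ^ k                                 ∎)

  open Kernel seriesRing using (φT-zero; φT-suc)

  private
    p q φ ψ : Series
    p = Kernel.p seriesRing z (const t) geometric geometric-rec
    q = Kernel.q seriesRing z (const t) geometric geometric-rec
    φ = Kernel.φ seriesRing z (const t) geometric geometric-rec
    ψ = φ K.- D φ

    T N : ℕ → Series
    T = Kernel.T seriesRing z (const t) geometric geometric-rec
    N = Kernel.N seriesRing z (const t) geometric geometric-rec

  q-⊛ : ∀ f k → (q ⊛ f) k ≈ (1# + t) * f k
  q-⊛ f k = begin
    ((K.1# K.+ const t) ⊛ f) k          ≈⟨ ⊛-distribʳ f K.1# (const t) k ⟩
    (K.1# ⊛ f) k + (const t ⊛ f) k      ≈⟨ +-cong (const-⊛ 1# f k) (const-⊛ t f k) ⟩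
    1# * f k + t * f k                  ≈⟨ distribʳ _ _ _ ⟨
    (1# + t) * f k                      ∎

  -- By Lagrange inversion L n f = [xⁿ] f(w) for the series w(x) = x φ(w).
  L : ℕ → Series → Carrier
  L zero    f = f 0
  L (suc n) f = (φ KE.^ n ⊛ ψ ⊛ f) (suc n)

  L-cong : ∀ n {f g} → f K.≈ g → L n f ≈ L n g
  L-cong zero    f≈g = f≈g 0
  L-cong (suc n) {f} {g} f≈g = K.*-congˡ {φ KE.^ n ⊛ ψ} {f} {g} f≈g (suc n)

  L-+ : ∀ n f g → L n (f K.+ g) ≈ L n f + L n g
  L-+ zero    f g = refl
  L-+ (suc n) f g = K.distribˡ (φ KE.^ n ⊛ ψ) f g (suc n)

  L-q : ∀ n f → L n (q ⊛ f) ≈ (1# + t) * L n f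
  L-q zero    f = q-⊛ f 0
  L-q (suc n) f = begin
    (A ⊛ (q ⊛ f)) (suc n)    ≈⟨ ⊛-assoc A q f (suc n) ⟨
    (A ⊛ q ⊛ f) (suc n)      ≈⟨ K.*-congʳ {f} {A ⊛ q} {q ⊛ A} (⊛-comm A q) (suc n) ⟩
    (q ⊛ A ⊛ f) (suc n)      ≈⟨ ⊛-assoc q A f (suc n) ⟩
    (q ⊛ (A ⊛ f)) (suc n)    ≈⟨ q-⊛ (A ⊛ f) (suc n) ⟩
    (1# + t) * L (suc n) f   ∎
    where
    A : Series
    A = φ KE.^ n ⊛ ψ

  ⊛-z : ∀ f g k → (f ⊛ (z ⊛ g)) (suc k) ≈ (f ⊛ g) k
  ⊛-z f g k = begin
    (f ⊛ (z ⊛ g)) (suc k)  ≈⟨ ⊛-comm f (z ⊛ g) (suc k) ⟩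
    (z ⊛ g ⊛ f) (suc k)    ≈⟨ ⊛-assoc z g f (suc k) ⟩
    (z ⊛ (g ⊛ f)) (suc k)  ≈⟨ z-⊛ (g ⊛ f) k ⟩
    (g ⊛ f) k              ≈⟨ ⊛-comm g f k ⟩
    (f ⊛ g) k              ∎

  L-z-zero : ∀ f → L 0 (z ⊛ f) ≈ 0#
  L-z-zero f = zeroˡ (f 0)

  -- For w = x φ(w) a factor w is the same as x φ(w), and the x lowers the index by one. So
  -- identities between series in z turn into recurrences in n.
  L-z-suc : ∀ n f → L (suc n) (z ⊛ f) ≈ L n (φ ⊛ f)
  -- `ψ` and `φ` have the same constant coefficient, since that of `D φ` is zero.
  L-z-suc zero f = begin
    (K.1# ⊛ ψ ⊛ (z ⊛ f)) 1   ≈⟨ ⊛-z (K.1# ⊛ ψ) f 0 ⟩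
    1# * (φ 0 + - 0#) * f 0  ≈⟨ *-congʳ (trans (*-identityˡ _) (trans (+-congˡ -0#≈0#) (+-identityʳ _))) ⟩
    φ 0 * f 0                ∎
    where
    open Algebra.Properties.Ring ring using (-0#≈0#)
  L-z-suc (suc n) f = begin
    (φ ⊛ A ⊛ ψ ⊛ (z ⊛ f)) (suc (suc n))   ≈⟨ ⊛-z (φ ⊛ A ⊛ ψ) f (suc n) ⟩
    (φ ⊛ A ⊛ ψ ⊛ f) (suc n)               ≈⟨ K.*-congʳ {f} {φ ⊛ A ⊛ ψ} {A ⊛ ψ ⊛ φ} eq (suc n) ⟩
    (A ⊛ ψ ⊛ φ ⊛ f) (suc n)               ≈⟨ ⊛-assoc (A ⊛ ψ) φ f (suc n) ⟩
    (A ⊛ ψ ⊛ (φ ⊛ f)) (suc n)             ∎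
    where
    A : Series
    A = φ KE.^ n
    eq : φ ⊛ A ⊛ ψ K.≈ A ⊛ ψ ⊛ φ
    eq = K.trans {φ ⊛ A ⊛ ψ} {φ ⊛ (A ⊛ ψ)} {A ⊛ ψ ⊛ φ} (⊛-assoc φ A ψ) (⊛-comm φ (A ⊛ ψ))

  Σ≤-× : ∀ k n f → Σ≤ k (λ j → n × f j) ≈ n × Σ≤ k f
  Σ≤-× zero    n f = refl
  Σ≤-× (suc k) n f = trans (+-congˡ (Σ≤-× k n (f ∘ suc))) (sym (×-distrib-+ _ _ n))

  ⊛-× : ∀ n f g k → (f ⊛ (λ j → n × g j)) k ≈ n × (f ⊛ g) k
  ⊛-× n f g k = trans (Σ≤-cong k (λ j → ×-comm-* n (f j) (g (k ∸ j)))) (Σ≤-× k n _)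

  D-^ : ∀ f n k → D (f KE.^ suc n) k ≈ suc n × (f KE.^ n ⊛ D f) k
  D-^ f zero k = begin
    D (f ⊛ K.1#) k       ≈⟨ ×-congʳ k (K.*-identityʳ f k) ⟩
    D f k                ≈⟨ K.*-identityˡ (D f) k ⟨
    (K.1# ⊛ D f) k       ≈⟨ ×-homo-1 _ ⟨
    1 × (K.1# ⊛ D f) k   ∎
  D-^ f (suc n) k = begin
    D (f ⊛ g) k                                          ≈⟨ D-⊛ f g k ⟩
    (D f ⊛ g) k + (f ⊛ D g) k                            ≈⟨ +-cong (⊛-comm (D f) g k) (K.*-congˡ {f} {D g} {λ j → suc n × (f KE.^ n ⊛ D f) j} (D-^ f n) k) ⟩
    (g ⊛ D f) k + (f ⊛ (λ j → suc n × (f KE.^ n ⊛ D f) j)) k  ≈⟨ +-congˡ (⊛-× (suc n) f (f KE.^ n ⊛ D f) k) ⟩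
    (g ⊛ D f) k + suc n × (f ⊛ (f KE.^ n ⊛ D f)) k       ≈⟨ +-congˡ (×-congʳ (suc n) (⊛-assoc f (f KE.^ n) (D f) k)) ⟨
    suc (suc n) × (g ⊛ D f) k                            ∎
    where
    g : Series
    g = f KE.^ suc n

  -- Comes from D φⁿ⁺¹ = (n + 1) φⁿ D φ. At k = n + 1 the two multiples of φⁿ⁺¹ cancel, which gives
  -- `L-1`; at k = n a single copy is left over, which is Lagrange's formula.
  euler : ∀ n k → suc n × (φ KE.^ n ⊛ ψ) k + k × (φ KE.^ suc n) k ≈ suc n × (φ KE.^ suc n) k
  euler n k = begin
    suc n × (A ⊛ ψ) k + D (φ KE.^ suc n) k          ≈⟨ +-congˡ (D-^ φ n k) ⟩
    suc n × (A ⊛ ψ) k + suc n × (A ⊛ D φ) k         ≈⟨ ×-distrib-+ _ _ (suc n) ⟨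
    suc n × ((A ⊛ ψ) k + (A ⊛ D φ) k)               ≈⟨ ×-congʳ (suc n) (K.distribˡ A ψ (D φ) k) ⟨
    suc n × (A ⊛ (ψ K.+ D φ)) k                     ≈⟨ ×-congʳ (suc n) (K.*-congˡ {A} {ψ K.+ D φ} {φ} ψ+Dφ k) ⟩
    suc n × (A ⊛ φ) k                               ≈⟨ ×-congʳ (suc n) (⊛-comm A φ k) ⟩
    suc n × (φ KE.^ suc n) k                        ∎
    where
    A : Series
    A = φ KE.^ n
    ψ+Dφ : ψ K.+ D φ K.≈ φ
    ψ+Dφ j = trans (+-assoc _ _ _) (trans (+-congˡ (-‿inverseˡ _)) (+-identityʳ _))

  -- Coefficients of the powers of φ

  p-^ : ∀ a k → (p KE.^ a) k ≈ (a C k) × 1#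
  p-^ zero    zero    = sym (×-homo-1 1#)
  p-^ zero    (suc k) = sym (×-congˡ {1#} (k>n⇒nCk≡0 {0} {suc k} (ℕ.s≤s ℕ.z≤n)))
  p-^ (suc a) zero    = begin
    (1# + 0#) * (p KE.^ a) 0   ≈⟨ *-congʳ (+-identityʳ 1#) ⟩
    1# * (p KE.^ a) 0          ≈⟨ *-identityˡ _ ⟩
    (p KE.^ a) 0               ≈⟨ p-^ a 0 ⟩
    1 × 1#                     ∎
  p-^ (suc a) (suc k) = begin
    (p ⊛ f) (suc k)                        ≈⟨ ⊛-distribʳ f K.1# z (suc k) ⟩
    (K.1# ⊛ f) (suc k) + (z ⊛ f) (suc k)   ≈⟨ +-cong (K.*-identityˡ f (suc k)) (z-⊛ f k) ⟩
    f (suc k) + f k                        ≈⟨ +-comm _ _ ⟩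
    f k + f (suc k)                        ≈⟨ +-cong (p-^ a k) (p-^ a (suc k)) ⟩
    (a C k) × 1# + (a C suc k) × 1#        ≈⟨ ×-homo-+ 1# (a C k) (a C suc k) ⟨
    (a C k ℕ.+ a C suc k) × 1#             ≈⟨ ×-congˡ (nCk+nC[k+1]≡[n+1]C[k+1] a k) ⟩
    (suc a C suc k) × 1#                   ∎
    where
    f : Series
    f = p KE.^ a

  geometric-^-rec : ∀ b k → (geometric KE.^ suc b) (suc k)
    ≈ (geometric KE.^ b) (suc k) + t * (geometric KE.^ suc b) k
  geometric-^-rec b k = begin
    (geometric ⊛ f) (suc k)
      ≈⟨ K.*-congʳ {f} {geometric} {K.1# K.+ const t ⊛ z ⊛ geometric} geometric-rec (suc k) ⟩
    ((K.1# K.+ const t ⊛ z ⊛ geometric) ⊛ f) (suc k)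
      ≈⟨ ⊛-distribʳ f K.1# (const t ⊛ z ⊛ geometric) (suc k) ⟩
    (K.1# ⊛ f) (suc k) + (const t ⊛ z ⊛ geometric ⊛ f) (suc k)
      ≈⟨ +-cong (K.*-identityˡ f (suc k)) (⊛-assoc (const t ⊛ z) geometric f (suc k)) ⟩
    f (suc k) + (const t ⊛ z ⊛ (geometric ⊛ f)) (suc k)
      ≈⟨ +-congˡ (⊛-assoc (const t) z (geometric ⊛ f) (suc k)) ⟩
    f (suc k) + (const t ⊛ (z ⊛ (geometric ⊛ f))) (suc k)
      ≈⟨ +-congˡ (const-⊛ t (z ⊛ (geometric ⊛ f)) (suc k)) ⟩
    f (suc k) + t * (z ⊛ (geometric ⊛ f)) (suc k)
      ≈⟨ +-congˡ (*-congˡ (z-⊛ (geometric ⊛ f) k)) ⟩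
    f (suc k) + t * (geometric ⊛ f) k ∎
    where
    f : Series
    f = geometric KE.^ b

  -- The negative binomial series of (1 - t z) to the power -(b + 1), obtained from
  -- `geometric-^-rec` by Pascal's rule.
  geometric-^ : ∀ b k → (geometric KE.^ suc b) k ≈ ((b ℕ.+ k) C k) × t ^ k
  geometric-^ zero    zero    = trans (*-identityˡ _) (sym (×-homo-1 1#))
  geometric-^ (suc b) zero    = trans (*-identityˡ _) (geometric-^ b zero)
  geometric-^ zero    (suc k) = begin
    (geometric ⊛ K.1#) (suc k)    ≈⟨ K.*-identityʳ geometric (suc k) ⟩
    t ^ suc k                     ≈⟨ ×-homo-1 _ ⟨
    1 × t ^ suc k                 ≈⟨ ×-congˡ (nCn≡1 (suc k)) ⟨
    (suc k C suc k) × t ^ suc k   ∎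
  geometric-^ (suc b) (suc k) = begin
    (geometric KE.^ suc (suc b)) (suc k)
      ≈⟨ geometric-^-rec (suc b) k ⟩
    (geometric KE.^ suc b) (suc k) + t * (geometric KE.^ suc (suc b)) k
      ≈⟨ +-cong (geometric-^ b (suc k)) (*-congˡ (geometric-^ (suc b) k)) ⟩
    ((b ℕ.+ suc k) C suc k) × t ^ suc k + t * (((suc b ℕ.+ k) C k) × t ^ k)
      ≈⟨ +-cong (×-congˡ (≡.cong (_C suc k) (ℕP.+-suc b k))) (×-comm-* ((suc b ℕ.+ k) C k) t (t ^ k)) ⟩
    ((suc b ℕ.+ k) C suc k) × t ^ suc k + ((suc b ℕ.+ k) C k) × t ^ suc k
      ≈⟨ +-comm _ _ ⟩
    ((suc b ℕ.+ k) C k) × t ^ suc k + ((suc b ℕ.+ k) C suc k) × t ^ suc k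
      ≈⟨ ×-homo-+ (t ^ suc k) ((suc b ℕ.+ k) C k) ((suc b ℕ.+ k) C suc k) ⟨
    ((suc b ℕ.+ k) C k ℕ.+ (suc b ℕ.+ k) C suc k) × t ^ suc k
      ≈⟨ ×-congˡ (nCk+nC[k+1]≡[n+1]C[k+1] (suc b ℕ.+ k) k) ⟩
    (suc (suc b ℕ.+ k) C suc k) × t ^ suc k
      ≈⟨ ×-congˡ (≡.cong (_C suc k) (ℕP.+-suc (suc b) k)) ⟨
    ((suc b ℕ.+ suc k) C suc k) × t ^ suc k ∎

  φ-^ : ∀ n k → (φ KE.^ suc n) k
    ≈ Σ≤ k (λ j → (((n ℕ.+ j) C j) ℕ.* ((3 ℕ.* suc n) C (k ∸ j))) × t ^ j)
  φ-^ n k = begin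
    (φ KE.^ suc n) k
      ≈⟨ KE.^-distrib-* (p ⊛ p ⊛ p) geometric (suc n) k ⟩
    ((p ⊛ p ⊛ p) KE.^ suc n ⊛ geometric KE.^ suc n) k
      ≈⟨ ⊛-comm ((p ⊛ p ⊛ p) KE.^ suc n) (geometric KE.^ suc n) k ⟩
    (geometric KE.^ suc n ⊛ (p ⊛ p ⊛ p) KE.^ suc n) k
      ≈⟨ K.*-congˡ {geometric KE.^ suc n} {(p ⊛ p ⊛ p) KE.^ suc n} {p KE.^ (3 ℕ.* suc n)} p³ k ⟩
    (geometric KE.^ suc n ⊛ p KE.^ (3 ℕ.* suc n)) k
      ≈⟨ Σ≤-cong k (λ j → *-cong (geometric-^ n j) (p-^ (3 ℕ.* suc n) (k ∸ j))) ⟩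
    Σ≤ k (λ j → ((n ℕ.+ j) C j) × t ^ j * (((3 ℕ.* suc n) C (k ∸ j)) × 1#))
      ≈⟨ Σ≤-cong k (λ j → simplify ((n ℕ.+ j) C j) ((3 ℕ.* suc n) C (k ∸ j)) (t ^ j)) ⟩
    Σ≤ k (λ j → (((n ℕ.+ j) C j) ℕ.* ((3 ℕ.* suc n) C (k ∸ j))) × t ^ j) ∎
    where
    cube : p ⊛ p ⊛ p K.≈ p KE.^ 3
    cube = K.trans {p ⊛ p ⊛ p} {p ⊛ (p ⊛ p)} {p KE.^ 3} (⊛-assoc p p p)
      (K.*-congˡ {p} {p ⊛ p} {p ⊛ (p ⊛ K.1#)} (K.*-congˡ {p} {p} {p ⊛ K.1#}
        (K.sym {p ⊛ K.1#} {p} (K.*-identityʳ p))))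
    p³ : (p ⊛ p ⊛ p) KE.^ suc n K.≈ p KE.^ (3 ℕ.* suc n)
    p³ j = trans (KE.^-congˡ (suc n) {p ⊛ p ⊛ p} {p KE.^ 3} cube j) (KE.^-assocʳ p 3 (suc n) j)
    simplify : ∀ a b x → a × x * (b × 1#) ≈ (a ℕ.* b) × x
    simplify a b x = begin
      a × x * (b × 1#)    ≈⟨ ×-assoc-* a x (b × 1#) ⟩
      a × (x * (b × 1#))  ≈⟨ ×-congʳ a (trans (×-comm-* b x 1#) (×-congʳ b (*-identityʳ x))) ⟩
      a × (b × x)         ≈⟨ ×-assocˡ x a b ⟩
      (a ℕ.* b) × x       ∎

  -- Solution of the recurrences in the height

  module Recurrence
    (torsion-free : ∀ n x → suc n × x ≈ 0# → x ≈ 0#)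
    (a b : ℕ → ℕ → Carrier)
    (a₀₀ : a 0 0 ≈ 1#)
    (a₀₊ : ∀ h → a 0 (suc h) ≈ a 0 h)
    (a₊₀ : ∀ n → a (suc n) 0 ≈ b n 0)
    (a₊₊ : ∀ n h → a (suc n) (suc h) ≈ b n (suc h) + a (suc n) h)
    (b₀ : ∀ n → b n 0 ≈ a n 1)
    (b₊ : ∀ n h → b n (suc h) ≈ a n (suc (suc h)) + (1# + t) * b n h)
    where

    -- The constant series 1 has no coefficient at xⁿ⁺¹, but through `ψ` this becomes visible only
    -- after multiplication by `suc n`; hence the hypothesis on torsion.
    L-1 : ∀ n → L (suc n) K.1# ≈ 0#
    L-1 n = torsion-free n _ (+-cancelʳ (suc n × (φ KE.^ suc n) (suc n)) _ _ (begin
      suc n × L (suc n) K.1# + G                      ≈⟨ +-congʳ (×-congʳ (suc n) (K.*-identityʳ (φ KE.^ n ⊛ ψ) (suc n))) ⟩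
      suc n × (φ KE.^ n ⊛ ψ) (suc n) + G              ≈⟨ euler n (suc n) ⟩
      G                                               ≈⟨ +-identityˡ _ ⟨
      0# + G                                          ∎))
      where
      G : Carrier
      G = suc n × (φ KE.^ suc n) (suc n)

    L-N₀ : ∀ n → L (suc n) (N 0) ≈ L (suc n) z
    L-N₀ n = trans (L-+ (suc n) K.1# z) (trans (+-congʳ (L-1 n)) (+-identityˡ _))

    L-N₀-φ : ∀ n → L (suc n) (N 0) ≈ L n (φ ⊛ T 0)
    L-N₀-φ n = trans (L-N₀ n)
      (trans (L-cong (suc n) {z} {z ⊛ K.1#} (K.sym {z ⊛ K.1#} {z} (K.*-identityʳ z)))
             (L-z-suc n K.1#))

    -- The height may grow along the recurrences, but they still descend: `a` at `suc n` refers to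
    -- `b` at `n`, `b` at `n` refers to `a` at `n`, and in all other references the height drops.
    mutual
      a-L : ∀ n h → a n h ≈ L n (N h)
      a-L zero    zero    = trans a₀₀ (sym (+-identityʳ 1#))
      a-L zero    (suc h) = trans (a₀₊ h) (trans (a-L zero h)
        (sym (trans (+-congˡ (L-z-zero (T (suc h)))) (+-identityʳ _))))
      a-L (suc n) zero    = trans (a₊₀ n) (trans (b-L n 0) (sym (L-N₀-φ n)))
      a-L (suc n) (suc h) = begin
        a (suc n) (suc h)                           ≈⟨ a₊₊ n h ⟩
        b n (suc h) + a (suc n) h                   ≈⟨ +-cong (b-L n (suc h)) (a-L (suc n) h) ⟩
        L n (φ ⊛ T (suc h)) + L (suc n) (N h)       ≈⟨ +-congʳ (L-z-suc n (T (suc h))) ⟨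
        L (suc n) (z ⊛ T (suc h)) + L (suc n) (N h) ≈⟨ +-comm _ _ ⟩
        L (suc n) (N h) + L (suc n) (z ⊛ T (suc h)) ≈⟨ L-+ (suc n) (N h) (z ⊛ T (suc h)) ⟨
        L (suc n) (N (suc h))                       ∎

      b-L : ∀ n h → b n h ≈ L n (φ ⊛ T h)
      b-L n zero    = trans (b₀ n) (trans (a-L n 1)
        (sym (L-cong n {φ ⊛ T 0} {N 1} (φT-zero z (const t) geometric geometric-rec))))
      b-L n (suc h) = begin
        b n (suc h)                                        ≈⟨ b₊ n h ⟩
        a n (suc (suc h)) + (1# + t) * b n h               ≈⟨ +-cong (a-L n (suc (suc h))) (*-congˡ (b-L n h)) ⟩
        L n (N (suc (suc h))) + (1# + t) * L n (φ ⊛ T h)   ≈⟨ +-congˡ (L-q n (φ ⊛ T h)) ⟨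
        L n (N (suc (suc h))) + L n (q ⊛ (φ ⊛ T h))        ≈⟨ L-+ n (N (suc (suc h))) (q ⊛ (φ ⊛ T h)) ⟨
        L n (N (suc (suc h)) K.+ q ⊛ (φ ⊛ T h))            ≈⟨ L-cong n {φ ⊛ T (suc h)} {N (suc (suc h)) K.+ q ⊛ (φ ⊛ T h)}
                                                               (φT-suc z (const t) geometric geometric-rec h) ⟨
        L n (φ ⊛ T (suc h))                                ∎

    closed-form : ∀ n → suc n × a (suc n) 0
      ≈ Σ≤ n (λ j → (((n ℕ.+ j) C j) ℕ.* ((3 ℕ.* suc n) C (n ∸ j))) × t ^ j)
    closed-form n = trans (+-cancelʳ (n × G) _ _ (begin
      suc n × a (suc n) 0 + n × G              ≈⟨ +-congʳ (×-congʳ (suc n) a≈) ⟩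
      suc n × (φ KE.^ n ⊛ ψ) n + n × G         ≈⟨ euler n n ⟩
      G + n × G                                ∎)) (φ-^ n n)
      where
      G : Carrier
      G = (φ KE.^ suc n) n
      a≈ : a (suc n) 0 ≈ (φ KE.^ n ⊛ ψ) n
      a≈ = begin
        a (suc n) 0                             ≈⟨ a-L (suc n) 0 ⟩
        L (suc n) (N 0)                         ≈⟨ L-N₀ n ⟩
        L (suc n) z                             ≈⟨ ⊛-comm (φ KE.^ n ⊛ ψ) z (suc n) ⟩
        (z ⊛ (φ KE.^ n ⊛ ψ)) (suc n)            ≈⟨ z-⊛ (φ KE.^ n ⊛ ψ) n ⟩
        (φ KE.^ n ⊛ ψ) n                        ∎

open import Data.Bool using (Bool; true; false)
open import Data.Empty using (⊥; ⊥-elim)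
open import Data.Fin as Fin using (Fin; zero; suc; toℕ; fromℕ<)
import Data.Fin.Properties as FinP
open import Data.Integer as ℤ using (ℤ; +_; -[1+_]; 0ℤ; 1ℤ)
import Data.Integer.Properties as ℤP
import Data.Integer.Tactic.RingSolver as ℤSolver
open import Data.List as List
  using (List; []; _∷_; _++_; length; filter; map; concatMap; allFin; applyUpTo; cartesianProduct; cartesianProductWith)
open import Data.List.Membership.Propositional using (_∈_; lose)
open import Data.List.Membership.Propositional.Properties
  using (∈-map⁺; ∈-map⁻; ∈-++⁺ˡ; ∈-++⁺ʳ; ∈-filter⁺; ∈-filter⁻; ∈-cartesianProduct⁺; ∈-cartesianProductWith⁺; ∈-allFin)
open import Data.List.Membership.Propositional.Properties.WithK using (unique∧set⇒bag)
open import Data.List.Properties using (filter-≐; length-map; length-++; map-upTo)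
open import Data.List.Relation.Binary.BagAndSetEquality using (∼bag⇒↭)
open import Data.List.Relation.Binary.Disjoint.Propositional using (Disjoint)
open import Data.List.Relation.Binary.Permutation.Propositional.Properties using (↭-length)
open import Data.List.Relation.Unary.All as Allˡ using ([]; _∷_) renaming (All to Allˡ)
open import Data.List.Relation.Unary.AllPairs using ([]; _∷_)
open import Data.List.Relation.Unary.Any using (satisfied) renaming (here to hereˡ; there to thereˡ)
open import Data.List.Relation.Unary.Unique.Propositional using (Unique)
import Data.List.Relation.Unary.Unique.Propositional.Properties as Unique
import Data.Nat.Tactic.RingSolver as ℕSolver
open import Data.Product using (_×_)
open import Data.Rational as ℚ using (ℚ; _/_)
import Data.Rational.Properties as ℚP
open import Data.Rational.Unnormalised as ℚᵘ using (mkℚᵘ; *≡*)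
import Data.Rational.Unnormalised.Properties as ℚᵘP
open import Data.Sum using (_⊎_; inj₁; inj₂)
open import Data.Unit using (⊤; tt)
open import Data.Vec as Vec using (Vec; []; _∷_; lookup; _[_]≔_)
open import Data.Vec.Membership.Propositional using () renaming (_∈_ to _∈ᵛ_)
import Data.Vec.Properties as VecP
open import Data.Vec.Relation.Unary.All as Allᵛ using ([]; _∷_) renaming (All to Allᵛ)
open import Data.Vec.Relation.Unary.AllPairs using ([]; _∷_) renaming (AllPairs to AllPairsᵛ)
open import Data.Vec.Relation.Unary.Any using (here; there)
open import Function.Bundles using (mk⇔)
open import Level using (0ℓ)
open import Relation.Binary using (tri<; tri≈; tri>)
open import Relation.Binary.PropositionalEquality
  using (_≡_; _≢_; refl; sym; trans; cong; cong₂; subst; subst₂; ≢-sym; module ≡-Reasoning)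
open import Relation.Nullary using (¬_; yes; no; contradiction)
open import Relation.Unary using (Pred; Decidable)

-- Occurrences of 12312

module _ {A : Set} {P Q : Pred A 0ℓ} (P? : Decidable P) (Q? : Decidable Q) (P⊆Q : ∀ {x} → P x → Q x) where

  length-filter-mono-≤ : ∀ xs → length (filter P? xs) ℕ.≤ length (filter Q? xs)
  length-filter-mono-≤ [] = z≤n
  length-filter-mono-≤ (x ∷ xs) with P? x | Q? x
  ... | yes _ | yes _ = s≤s (length-filter-mono-≤ xs)
  ... | yes p | no ¬q = contradiction (P⊆Q p) ¬q
  ... | no _  | yes _ = ℕP.m≤n⇒m≤1+n (length-filter-mono-≤ xs)
  ... | no _  | no _  = length-filter-mono-≤ xs

  length-filter-mono-< : ∀ {y xs} → y ∈ xs → Q y → ¬ P y → length (filter P? xs) ℕ.< length (filter Q? xs)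
  length-filter-mono-< {y} {_ ∷ xs} (hereˡ refl) q ¬p with P? y | Q? y
  ... | yes p | _     = contradiction p ¬p
  ... | no _  | yes _ = s≤s (length-filter-mono-≤ xs)
  ... | no _  | no ¬q = contradiction q ¬q
  length-filter-mono-< {y} {x ∷ xs} (thereˡ y∈xs) q ¬p with P? x | Q? x
  ... | yes _ | yes _ = s≤s (length-filter-mono-< y∈xs q ¬p)
  ... | yes p | no ¬q = contradiction (P⊆Q p) ¬q
  ... | no _  | yes _ = ℕP.m≤n⇒m≤1+n (length-filter-mono-< y∈xs q ¬p)
  ... | no _  | no _  = length-filter-mono-< y∈xs q ¬p

allVecs-suc : ∀ N k → allVecs N (suc k) ≡ cartesianProductWith _∷_ (allFin N) (allVecs N k)
allVecs-suc N k = go (allFin N)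
  where
  go : ∀ xs → concatMap (λ x → map (x ∷_) (allVecs N k)) xs ≡ cartesianProductWith _∷_ xs (allVecs N k)
  go []       = refl
  go (x ∷ xs) = cong (map (x ∷_) (allVecs N k) List.++_) (go xs)

∈-allVecs : ∀ {N k} (v : Vec (Fin N) k) → v ∈ allVecs N k
∈-allVecs []      = hereˡ refl
∈-allVecs {N} {suc k} (x ∷ v) = subst (x ∷ v ∈_) (sym (allVecs-suc N k))
  (∈-cartesianProductWith⁺ _∷_ (∈-allFin x) (∈-allVecs v))

allVecs-unique : ∀ N k → Unique (allVecs N k)
allVecs-unique N zero    = [] ∷ []
allVecs-unique N (suc k) = subst Unique (sym (allVecs-suc N k))
  (Unique.cartesianProductWith⁺ _∷_ VecP.∷-injective (Unique.allFin⁺ N) (allVecs-unique N k))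

steps⇒mono : ∀ {n} (f : Fin (suc n) → ℕ) → (∀ c → f (Fin.inject₁ c) ℕ.< f (suc c)) →
             ∀ {a b} → a Fin.< b → f a ℕ.< f b
steps⇒mono {suc n} f step {zero}  {suc zero}    _         = step zero
steps⇒mono {suc n} f step {zero}  {suc (suc b)} _         =
  ℕP.<-trans (step zero) (steps⇒mono (λ c → f (suc c)) (λ c → step (suc c)) {zero} {suc b} (s≤s z≤n))
steps⇒mono {suc n} f step {suc a} {suc b}       (s≤s a<b) =
  steps⇒mono (λ c → f (suc c)) (λ c → step (suc c)) a<b

mono⇒reflects : ∀ {n} (f : Fin n → ℕ) → (∀ {a b} → a Fin.< b → f a ℕ.< f b) →
                ∀ {a b} → f a ℕ.< f b → a Fin.< b
mono⇒reflects f mono {a} {b} fa<fb with FinP.<-cmp a b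
... | tri< a<b _ _  = a<b
... | tri≈ _ refl _ = contradiction fa<fb (ℕP.<-irrefl refl)
... | tri> _ _ b<a  = contradiction (mono b<a) (ℕP.<-asym fa<fb)

-- `i`, `j`, `k` carry the letters 1, 2, 3 of an occurrence of 12312, whose last two letters sit on
-- the partners of `i` and `j`. Admitting only openers as `k` is no loss, by `occurrence⇒barred`.
BarredCrossing : ∀ {N} → Vec (Fin N) N → Fin N → Fin N → Fin N → Set
BarredCrossing v i j k = (i Fin.< j) × (j Fin.< k) × (k Fin.< lookup v i) × (lookup v i Fin.< lookup v j) × (k Fin.< lookup v k)

-- Labels of the canonical sequential form

module Labels {N} (v : Vec (Fin N) N) (M : IsMatching v) where

  private
    V : Fin N → Fin N
    V = lookup v

  involutive : ∀ x → V (V x) ≡ x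
  involutive x = proj₂ (M x)

  label-V : ∀ x → label v (V x) ≡ label v x
  label-V x = cong length (filter-≐ _ _
    ((λ (a , b , c) → subst (_ Fin.≤_) (involutive x) b , a , c) ,
     (λ (a , b , c) → b , subst (_ Fin.≤_) (sym (involutive x)) a , c)) (allFin N))

  -- Strict because the initial point y is counted in its own label but not in that of x.
  label-strict : ∀ {x y} → x Fin.< V x → y Fin.< V y → x Fin.< y → label v x ℕ.< label v y
  label-strict {x} {y} x<Vx y<Vy x<y = length-filter-mono-< _ _
    (λ (a , _ , c) → ℕP.≤-trans a (ℕP.<⇒≤ x<y) , ℕP.≤-trans a (ℕP.<⇒≤ (ℕP.<-trans x<y y<Vy)) , c)
    (∈-allFin y) (ℕP.≤-refl , ℕP.<⇒≤ y<Vy , y<Vy) (λ (a , _) → ℕP.<⇒≱ x<y a)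

  initial : ∀ x → Σ[ o ∈ Fin N ] (o Fin.< V o) × (x ≡ o ⊎ x ≡ V o)
  initial x with FinP.<-cmp x (V x)
  ... | tri< x<Vx _ _ = x , x<Vx , inj₁ refl
  ... | tri≈ _ e _    = contradiction (sym e) (proj₁ (M x))
  ... | tri> _ _ Vx<x = V x , subst (V x Fin.<_) (sym (involutive x)) Vx<x , inj₂ (sym (involutive x))

  label-initial : ∀ {x o} → x ≡ o ⊎ x ≡ V o → label v x ≡ label v o
  label-initial (inj₁ refl) = refl
  label-initial {o = o} (inj₂ refl) = label-V o

  label-injective : ∀ {x y} → x Fin.< V x → y Fin.< V y → label v x ≡ label v y → x ≡ y
  label-injective {x} {y} x<Vx y<Vy e with FinP.<-cmp x y
  ... | tri< x<y _ _ = contradiction e (ℕP.<⇒≢ (label-strict x<Vx y<Vy x<y))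
  ... | tri≈ _ x≡y _ = x≡y
  ... | tri> _ _ y<x = contradiction (sym e) (ℕP.<⇒≢ (label-strict y<Vy x<Vx y<x))

  label-reflects-< : ∀ {x y} → x Fin.< V x → y Fin.< V y → label v x ℕ.< label v y → x Fin.< y
  label-reflects-< {x} {y} x<Vx y<Vy l with FinP.<-cmp x y
  ... | tri< x<y _ _ = x<y
  ... | tri≈ _ refl _ = contradiction l (ℕP.<-irrefl refl)
  ... | tri> _ _ y<x = contradiction (label-strict y<Vy x<Vx y<x) (ℕP.<-asym l)

  label-≡⇒edge : ∀ {x y} → x Fin.< y → label v x ≡ label v y → y ≡ V x × x Fin.< V x
  label-≡⇒edge {x} {y} x<y e with initial x | initial y
  ... | o , o<Vo , x∈ | o′ , o′<Vo′ , y∈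
    with label-injective o<Vo o′<Vo′ (trans (sym (label-initial x∈)) (trans e (label-initial y∈)))
  label-≡⇒edge x<y e | o , o<Vo , inj₁ refl | .o , _ , inj₁ refl | refl = contradiction x<y (ℕP.<-irrefl refl)
  label-≡⇒edge x<y e | o , o<Vo , inj₁ refl | .o , _ , inj₂ refl | refl = refl , o<Vo
  label-≡⇒edge x<y e | o , o<Vo , inj₂ refl | .o , _ , inj₁ refl | refl = contradiction x<y (ℕP.<-asym o<Vo)
  label-≡⇒edge x<y e | o , o<Vo , inj₂ refl | .o , _ , inj₂ refl | refl = contradiction x<y (ℕP.<-irrefl refl)

  label-unrelated : ∀ {x y} → ¬ label v x ℕ.< label v y → ¬ label v y ℕ.< label v x → label v x ≡ label v y
  label-unrelated {x} {y} x≮y y≮x with ℕP.<-cmp (label v x) (label v y)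
  ... | tri< l _ _ = contradiction l x≮y
  ... | tri≈ _ e _ = e
  ... | tri> _ _ g = contradiction g y≮x

  -- The letter 3 may stand on a closer `c`. The opener `k` of its edge comes no later than `c`,
  -- hence before `i′`, and it comes after `j` because its label is larger; so `k` can replace `c`.
  occurrence⇒barred : ∀ s → IsOccurrence (label v) p12312 s →
    Σ[ i ∈ Fin N ] Σ[ j ∈ Fin N ] Σ[ k ∈ Fin N ] BarredCrossing v i j k
  occurrence⇒barred (i ∷ j ∷ c ∷ i′ ∷ j′ ∷ []) occ =
    let i′≡ , _     = label-≡⇒edge (ℕP.<-trans i<j (ℕP.<-trans j<c c<i′)) (same f0 f3 (ℕP.<-irrefl refl) (ℕP.<-irrefl refl))
        j′≡ , j<Vj  = label-≡⇒edge (ℕP.<-trans j<c (ℕP.<-trans c<i′ i′<j′)) (same f1 f4 (ℕP.<-irrefl refl) (ℕP.<-irrefl refl))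
        k , k<Vk , c∈ = initial c
        j<k = label-reflects-< j<Vj k<Vk
                (subst (label v j ℕ.<_) (label-initial c∈) (proj₁ (proj₂ (occ f1 f2)) (s≤s (s≤s (s≤s z≤n)))))
    in i , j , k , i<j , j<k
       , subst (k Fin.<_) i′≡ (ℕP.≤-<-trans (k≤ c∈ k<Vk) c<i′)
       , subst₂ Fin._<_ i′≡ j′≡ i′<j′ , k<Vk
    where
    f0 f1 f2 f3 f4 : Fin 5
    f0 = zero
    f1 = suc zero
    f2 = suc (suc zero)
    f3 = suc (suc (suc zero))
    f4 = suc (suc (suc (suc zero)))
    s : Vec (Fin N) 5
    s = i ∷ j ∷ c ∷ i′ ∷ j′ ∷ []
    i<j : i Fin.< j
    i<j = proj₁ (occ f0 f1) (s≤s z≤n)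
    j<c : j Fin.< c
    j<c = proj₁ (occ f1 f2) (s≤s (s≤s z≤n))
    c<i′ : c Fin.< i′
    c<i′ = proj₁ (occ f2 f3) (s≤s (s≤s (s≤s z≤n)))
    i′<j′ : i′ Fin.< j′
    i′<j′ = proj₁ (occ f3 f4) (s≤s (s≤s (s≤s (s≤s z≤n))))
    same : ∀ a b → ¬ lookup p12312 a ℕ.< lookup p12312 b → ¬ lookup p12312 b ℕ.< lookup p12312 a →
           label v (lookup s a) ≡ label v (lookup s b)
    same a b a≮b b≮a = label-unrelated (λ l → a≮b (proj₂ (proj₂ (occ a b)) l)) (λ l → b≮a (proj₂ (proj₂ (occ b a)) l))
    k≤ : ∀ {k} → c ≡ k ⊎ c ≡ V k → k Fin.< V k → k Fin.≤ c
    k≤ (inj₁ refl) _   = ℕP.≤-refl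
    k≤ (inj₂ refl) k<Vk = ℕP.<⇒≤ k<Vk

  barred⇒occurrence : ∀ {i j k} → BarredCrossing v i j k →
    IsOccurrence (label v) p12312 (i ∷ j ∷ k ∷ V i ∷ V j ∷ [])
  barred⇒occurrence {i} {j} {k} (i<j , j<k , k<Vi , Vi<Vj , k<Vk) a b =
    steps⇒mono (λ c → toℕ (lookup s c)) step {a} {b}
    , (λ τ< → subst₂ ℕ._<_ (sym (label-s a)) (sym (label-s b))
                 (edge-mono (ℕP.≤-pred (subst₂ ℕ._<_ (letter-p12312 a) (letter-p12312 b) τ<))))
    , (λ l → subst₂ ℕ._<_ (sym (letter-p12312 a)) (sym (letter-p12312 b))
                 (s≤s (mono⇒reflects (λ c → label v (edge c)) edge-mono (subst₂ ℕ._<_ (label-s a) (label-s b) l))))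
    where
    i<Vi : i Fin.< V i
    i<Vi = ℕP.<-trans i<j (ℕP.<-trans j<k k<Vi)
    j<Vj : j Fin.< V j
    j<Vj = ℕP.<-trans j<k (ℕP.<-trans k<Vi Vi<Vj)
    s : Vec (Fin N) 5
    s = i ∷ j ∷ k ∷ V i ∷ V j ∷ []
    step : ∀ (c : Fin 4) → lookup s (Fin.inject₁ c) Fin.< lookup s (suc c)
    step zero = i<j
    step (suc zero) = j<k
    step (suc (suc zero)) = k<Vi
    step (suc (suc (suc zero))) = Vi<Vj
    -- Pattern and labels both factor through the three edges, so all comparisons of letters reduce
    -- to the monotonicity of `label v` on `edge`.
    letter : Fin 5 → Fin 3
    letter zero                         = zero
    letter (suc zero)                   = suc zero
    letter (suc (suc zero))             = suc (suc zero)
    letter (suc (suc (suc zero)))       = zero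
    letter (suc (suc (suc (suc zero)))) = suc zero
    letter-p12312 : ∀ a → lookup p12312 a ≡ suc (toℕ (letter a))
    letter-p12312 zero                         = refl
    letter-p12312 (suc zero)                   = refl
    letter-p12312 (suc (suc zero))             = refl
    letter-p12312 (suc (suc (suc zero)))       = refl
    letter-p12312 (suc (suc (suc (suc zero)))) = refl
    edge : Fin 3 → Fin N
    edge zero             = i
    edge (suc zero)       = j
    edge (suc (suc zero)) = k
    label-s : ∀ a → label v (lookup s a) ≡ label v (edge (letter a))
    label-s zero                         = refl
    label-s (suc zero)                   = refl
    label-s (suc (suc zero))             = refl
    label-s (suc (suc (suc zero)))       = label-V i
    label-s (suc (suc (suc (suc zero)))) = label-V j
    edge-step : ∀ (c : Fin 2) → label v (edge (Fin.inject₁ c)) ℕ.< label v (edge (suc c))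
    edge-step zero       = label-strict i<Vi j<Vj i<j
    edge-step (suc zero) = label-strict j<Vj k<Vk j<k
    edge-mono : ∀ {c d} → c Fin.< d → label v (edge c) ℕ.< label v (edge d)
    edge-mono = steps⇒mono (λ c → label v (edge c)) edge-step

  avoids⇒¬barred : Avoids v p12312 → ∀ {i j k} → ¬ BarredCrossing v i j k
  avoids⇒¬barred avoids {i} {j} {k} barred =
    avoids (lose (∈-allVecs (i ∷ j ∷ k ∷ V i ∷ V j ∷ [])) (barred⇒occurrence barred))

  ¬barred⇒avoids : (∀ {i j k} → ¬ BarredCrossing v i j k) → Avoids v p12312
  ¬barred⇒avoids ¬barred contains =
    let s , occ = satisfied contains
        _ , _ , _ , barred = occurrence⇒barred s occ
    in ¬barred barred

-- Readings of matchings as lattice paths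

-- Reading a matching from left to right with the stack of open edges, Path f n h m describes the
-- rest of a reading with n edges still to be opened, h open edges and m crossings still to come.
-- A closer belongs to the top edge or, if the top edge was opened last, to the edge under it; the
-- flag f is false once the latter is excluded until the next opening.
data Path : Bool → ℕ → ℕ → ℕ → Set where
  done  : Path false 0 0 0
  up    : ∀ {n h m} → Path true n (suc h) m → Path false (suc n) h m
  top   : ∀ {n h m} → Path false n h m → Path false n (suc h) m
  stay  : ∀ {n h m} → Path false n (suc h) m → Path true n (suc h) m
  under : ∀ {n h m} → Path true n (suc h) m → Path true n (suc (suc h)) (suc m)

size : ∀ {f n h m} → Path f n h m → ℕ
size done      = 0
size (up π)    = suc (size π)
size (top π)   = suc (size π)
size (stay π)  = size π
size (under π) = suc (size π)

size-≡ : ∀ {f n h m} (π : Path f n h m) → size π ≡ 2 ℕ.* n ℕ.+ h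
size-≡ done = refl
size-≡ (up {n} {h} π) rewrite size-≡ π | ℕP.+-suc n (n ℕ.+ 0) | ℕP.+-suc (n ℕ.+ (n ℕ.+ 0)) h = refl
size-≡ (top {n} {h} π) rewrite size-≡ π = sym (ℕP.+-suc (2 ℕ.* n) h)
size-≡ (stay π) = size-≡ π
size-≡ (under {n} {h} π) rewrite size-≡ π = sym (ℕP.+-suc (2 ℕ.* n) (suc h))

-- Traces: partner maps read along a path

module _ {N : ℕ} where

  -- `v` is the partner map, the number is the next position to be read, and the vector lists the
  -- openers of the open edges with the top first. Both equations of an edge are stored at its
  -- closer; its opener records only the direction.
  data Trace (v : Fin N → Fin N) : ∀ {f n h m} → ℕ → Vec (Fin N) h → Path f n h m → Set where
    done  : Trace v N [] done
    up    : ∀ {n h m} {st : Vec (Fin N) h} {π : Path true n (suc h) m} x →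
            x Fin.< v x → Trace v (suc (toℕ x)) (x ∷ st) π → Trace v (toℕ x) st (up π)
    top   : ∀ {n h m a} {st : Vec (Fin N) h} {π : Path false n h m} x →
            v x ≡ a → v a ≡ x → a Fin.< x →
            Trace v (suc (toℕ x)) st π → Trace v (toℕ x) (a ∷ st) (top π)
    stay  : ∀ {n h m p} {st : Vec (Fin N) (suc h)} {π : Path false n (suc h) m} →
            Trace v p st π → Trace v p st (stay π)
    under : ∀ {n h m a b} {st : Vec (Fin N) h} {π : Path true n (suc h) m} x →
            v x ≡ a → v a ≡ x → a Fin.< b → b Fin.< x →
            Trace v (suc (toℕ x)) (b ∷ st) π → Trace v (toℕ x) (b ∷ a ∷ st) (under π)

  -- The points at which a trace from position `p` constrains the partner map.
  Remaining : ∀ {h} → ℕ → Vec (Fin N) h → Fin N → Set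
  Remaining p st y = p ℕ.≤ toℕ y ⊎ y ∈ᵛ st

  ≤⇒≡∨< : ∀ {x y : Fin N} → x Fin.≤ y → x ≡ y ⊎ x Fin.< y
  ≤⇒≡∨< {x} {y} x≤y with ℕP.m≤n⇒m<n∨m≡n x≤y
  ... | inj₁ x<y = inj₂ x<y
  ... | inj₂ e   = inj₁ (FinP.toℕ-injective e)

  trace-late : ∀ {v f n h m p} {st : Vec (Fin N) h} {π : Path f n h m} →
               Trace v p st π → ∀ {y} → y ∈ᵛ st → p ℕ.≤ toℕ (v y)
  trace-late (up x x<vx tr) y∈ = ℕP.<⇒≤ (trace-late tr (there y∈))
  trace-late (top x e e′ a<x tr) (here refl) rewrite e′ = ℕP.≤-refl
  trace-late (top x e e′ a<x tr) (there y∈) = ℕP.<⇒≤ (trace-late tr y∈)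
  trace-late (stay tr) y∈ = trace-late tr y∈
  trace-late (under x e e′ a<b b<x tr) (here refl) = ℕP.<⇒≤ (trace-late tr (here refl))
  trace-late (under x e e′ a<b b<x tr) (there (here refl)) rewrite e′ = ℕP.≤-refl
  trace-late (under x e e′ a<b b<x tr) (there (there y∈)) = ℕP.<⇒≤ (trace-late tr (there y∈))

  trace-cong : ∀ {v w f n h m p} {st : Vec (Fin N) h} {π : Path f n h m} →
               (∀ y → Remaining p st y → v y ≡ w y) → Trace v p st π → Trace w p st π
  trace-cong v≡w done = done
  trace-cong v≡w (up x x<vx tr) = up x (subst (x Fin.<_) (v≡w x (inj₁ ℕP.≤-refl)) x<vx)
    (trace-cong (λ { y (inj₁ p≤y) → v≡w y (inj₁ (ℕP.<⇒≤ p≤y))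
                   ; y (inj₂ (here refl)) → v≡w y (inj₁ ℕP.≤-refl)
                   ; y (inj₂ (there y∈)) → v≡w y (inj₂ y∈) }) tr)
  trace-cong v≡w (top x e e′ a<x tr) =
    top x (trans (sym (v≡w x (inj₁ ℕP.≤-refl))) e) (trans (sym (v≡w _ (inj₂ (here refl)))) e′) a<x
      (trace-cong (λ { y (inj₁ p≤y) → v≡w y (inj₁ (ℕP.<⇒≤ p≤y))
                     ; y (inj₂ y∈) → v≡w y (inj₂ (there y∈)) }) tr)
  trace-cong v≡w (stay tr) = stay (trace-cong v≡w tr)
  trace-cong v≡w (under x e e′ a<b b<x tr) =
    under x (trans (sym (v≡w x (inj₁ ℕP.≤-refl))) e) (trans (sym (v≡w _ (inj₂ (there (here refl))))) e′) a<b b<x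
      (trace-cong (λ { y (inj₁ p≤y) → v≡w y (inj₁ (ℕP.<⇒≤ p≤y))
                     ; y (inj₂ (here refl)) → v≡w y (inj₂ (here refl))
                     ; y (inj₂ (there y∈)) → v≡w y (inj₂ (there (there y∈))) }) tr)

  trace-determines : ∀ {v w f n h m p} {st : Vec (Fin N) h} {π : Path f n h m} →
                     Trace v p st π → Trace w p st π → ∀ y → Remaining p st y → v y ≡ w y
  trace-determines {v} {w} tr tr′ = go tr tr′ refl
    where
    -- The positions are compared propositionally because toℕ cannot be unified away.
    go : ∀ {f n h m p p′} {st : Vec (Fin N) h} {π : Path f n h m} →
         Trace v p st π → Trace w p′ st π → p ≡ p′ → ∀ y → Remaining p st y → v y ≡ w y
    go done done _ y (inj₁ N≤y) = contradiction (FinP.toℕ<n y) (ℕP.≤⇒≯ N≤y)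
    go (up x _ tr) (up x′ _ tr′) e y r with FinP.toℕ-injective e
    ... | refl = go tr tr′ refl y (next r)
      where
      next : ∀ {y} → Remaining (toℕ x) _ y → Remaining (suc (toℕ x)) (x ∷ _) y
      next (inj₁ p≤y) with ≤⇒≡∨< p≤y
      ... | inj₁ refl = inj₂ (here refl)
      ... | inj₂ p<y  = inj₁ p<y
      next (inj₂ y∈) = inj₂ (there y∈)
    go (top x e₁ e₂ _ tr) (top x′ e₁′ e₂′ _ tr′) e y r with FinP.toℕ-injective e
    go (top x e₁ e₂ _ tr) (top x′ e₁′ e₂′ _ tr′) e y (inj₁ p≤y) | refl with ≤⇒≡∨< p≤y
    ... | inj₁ refl = trans e₁ (sym e₁′)
    ... | inj₂ p<y  = go tr tr′ refl y (inj₁ p<y)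
    go (top x e₁ e₂ _ tr) (top x′ e₁′ e₂′ _ tr′) e y (inj₂ (here refl)) | refl = trans e₂ (sym e₂′)
    go (top x e₁ e₂ _ tr) (top x′ e₁′ e₂′ _ tr′) e y (inj₂ (there y∈)) | refl = go tr tr′ refl y (inj₂ y∈)
    go (stay tr) (stay tr′) e y r = go tr tr′ e y r
    go (under x e₁ e₂ _ _ tr) (under x′ e₁′ e₂′ _ _ tr′) e y r with FinP.toℕ-injective e
    go (under x e₁ e₂ _ _ tr) (under x′ e₁′ e₂′ _ _ tr′) e y (inj₁ p≤y) | refl with ≤⇒≡∨< p≤y
    ... | inj₁ refl = trans e₁ (sym e₁′)
    ... | inj₂ p<y  = go tr tr′ refl y (inj₁ p<y)
    go (under x e₁ e₂ _ _ tr) (under x′ e₁′ e₂′ _ _ tr′) e y (inj₂ (here refl)) | refl = go tr tr′ refl y (inj₂ (here refl))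
    go (under x e₁ e₂ _ _ tr) (under x′ e₁′ e₂′ _ _ tr′) e y (inj₂ (there (here refl))) | refl = trans e₂ (sym e₂′)
    go (under x e₁ e₂ _ _ tr) (under x′ e₁′ e₂′ _ _ tr′) e y (inj₂ (there (there y∈))) | refl = go tr tr′ refl y (inj₂ (there y∈))

  -- The next point decides the step: after `stay` it opens an edge or closes that of the top,
  -- whereas `under` closes the edge below the top.
  trace-path-unique : ∀ {v f n h m p} {st : Vec (Fin N) h} {π π′ : Path f n h m} →
                      Trace v p st π → Trace v p st π′ → π ≡ π′
  trace-path-unique {v} tr tr′ = go tr tr′ refl
    where
    go : ∀ {f n h m p p′} {st : Vec (Fin N) h} {π π′ : Path f n h m} →
         Trace v p st π → Trace v p′ st π′ → p ≡ p′ → π ≡ π′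
    go done done _ = refl
    go (up x _ tr) (up x′ _ tr′) e with FinP.toℕ-injective e
    ... | refl = cong up (go tr tr′ refl)
    go (up x x<vx _) (top x′ refl _ vx<x _) e with FinP.toℕ-injective e
    ... | refl = contradiction x<vx (ℕP.<-asym vx<x)
    go (top x refl _ vx<x _) (up x′ x<vx _) e with FinP.toℕ-injective e
    ... | refl = contradiction x<vx (ℕP.<-asym vx<x)
    go (top x _ _ _ tr) (top x′ _ _ _ tr′) e with FinP.toℕ-injective e
    ... | refl = cong top (go tr tr′ refl)
    go (stay tr) (stay tr′) e = cong stay (go tr tr′ e)
    go (under x _ _ _ _ tr) (under x′ _ _ _ _ tr′) e with FinP.toℕ-injective e
    ... | refl = cong under (go tr tr′ refl)
    go (stay tr) (under x e₁ _ a<b b<x tr′) e = ⊥-elim (clash tr e e₁ a<b b<x)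
      where
      clash : ∀ {n h m p a b x} {st : Vec (Fin N) h} {π : Path false n (suc (suc h)) m} →
              Trace v p (b ∷ a ∷ st) π → p ≡ toℕ x → v x ≡ a → a Fin.< b → b Fin.< x → ⊥
      clash (up x x<vx _) e refl a<b b<x with FinP.toℕ-injective e
      ... | refl = ℕP.<-asym x<vx (ℕP.<-trans a<b b<x)
      clash (top x refl _ _ _) e refl a<b b<x with FinP.toℕ-injective e
      ... | refl = ℕP.<-irrefl refl a<b
    go (under x e₁ e₂ a<b b<x tr′) (stay tr) e = sym (go (stay tr) (under x e₁ e₂ a<b b<x tr′) (sym e))

-- From paths to matchings

module _ {N : ℕ} where

  Below : ∀ {h} → ℕ → Vec (Fin N) h → Set
  Below p st = Allᵛ (λ a → toℕ a ℕ.< p) st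

  Decreasing : ∀ {h} → Vec (Fin N) h → Set
  Decreasing st = AllPairsᵛ Fin._>_ st

  -- Kept from unfolding so that proofs about build can abstract over it.
  abstract
    next : ∀ {p r} → p ℕ.+ suc r ≡ N → Σ[ x ∈ Fin N ] toℕ x ≡ p × suc (toℕ x) ℕ.+ r ≡ N
    next {p} {r} eq = x , x≡ , trans (cong (λ k → suc k ℕ.+ r) x≡) (trans (sym (ℕP.+-suc p r)) eq)
      where
      p<N : p ℕ.< N
      p<N = subst (p ℕ.<_) eq (subst (p ℕ.<_) (sym (ℕP.+-suc p r)) (s≤s (ℕP.m≤m+n p r)))
      x : Fin N
      x = fromℕ< p<N
      x≡ : toℕ x ≡ p
      x≡ = FinP.toℕ-fromℕ< p<N

  link : Fin N → Fin N → Vec (Fin N) N → Vec (Fin N) N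
  link x a w = w [ x ]≔ a [ a ]≔ x

  -- Edges are entered at their closers, from right to left. The identity map at `done` is a
  -- placeholder; when the reading starts at position 0 with an empty stack, every entry gets
  -- overwritten.
  build : ∀ {f n h m p} → Vec (Fin N) h → (π : Path f n h m) → p ℕ.+ size π ≡ N → Vec (Fin N) N
  build st done _ = Vec.allFin N
  build st (up π) eq = let x , _ , eq′ = next eq in build (x ∷ st) π eq′
  build (a ∷ st) (top π) eq = let x , _ , eq′ = next eq in link x a (build st π eq′)
  build st (stay π) eq = build st π eq
  build (b ∷ a ∷ st) (under π) eq = let x , _ , eq′ = next eq in link x a (build (b ∷ st) π eq′)

  link-x : ∀ x a w → a Fin.< x → lookup (link x a w) x ≡ a
  link-x x a w a<x = trans (VecP.lookup∘update′ (≢-sym (FinP.<⇒≢ a<x)) (w [ x ]≔ a) x) (VecP.lookup∘update x w a)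

  link-a : ∀ x a w → lookup (link x a w) a ≡ x
  link-a x a w = VecP.lookup∘update a (w [ x ]≔ a) x

  link-other : ∀ x a w {y} → y ≢ x → y ≢ a → lookup w y ≡ lookup (link x a w) y
  link-other x a w y≢x y≢a = sym (trans (VecP.lookup∘update′ y≢a (w [ x ]≔ a) x) (VecP.lookup∘update′ y≢x w a))

  raise : ∀ {h p} {st : Vec (Fin N) h} → Below p st → Below (suc p) st
  raise = Allᵛ.map ℕP.m<n⇒m<1+n

  -- `Below` and `Decreasing` keep the open edges distinct, so linking `x` with `a` changes no
  -- partner on which the rest of the trace depends.
  build-trace : ∀ {f n h m p} (st : Vec (Fin N) h) (π : Path f n h m) (eq : p ℕ.+ size π ≡ N) →
                Below p st → Decreasing st → Trace (lookup (build st π eq)) p st π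
  build-trace [] done eq below dec rewrite trans (sym (ℕP.+-identityʳ _)) eq = done
  build-trace st (up π) eq below dec with next eq
  -- The direction of the edge at `x` is read off the rest of the trace, where `x` lies on the stack
  -- and is closed later.
  ... | x , refl , eq′ = up x (trace-late tr (here refl)) tr
    where tr = build-trace (x ∷ st) π eq′ (ℕP.≤-refl ∷ raise below) (below ∷ dec)
  build-trace (a ∷ st) (top π) eq (a<x ∷ below) (a> ∷ dec) with next eq
  ... | x , refl , eq′ = top x (link-x x a w a<x) (link-a x a w) a<x
      (trace-cong (λ { y (inj₁ x<y) → link-other x a w (≢-sym (FinP.<⇒≢ x<y)) (≢-sym (FinP.<⇒≢ (ℕP.<-trans a<x x<y)))
                     ; y (inj₂ y∈)  → link-other x a w (FinP.<⇒≢ (Allᵛ.lookup below y∈)) (FinP.<⇒≢ (Allᵛ.lookup a> y∈)) })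
        (build-trace st π eq′ (raise below) dec))
    where w = build st π eq′
  build-trace st (stay π) eq below dec = stay (build-trace st π eq below dec)
  build-trace (b ∷ a ∷ st) (under π) eq (b<x ∷ a<x ∷ below) ((a<b ∷ b>) ∷ a> ∷ dec) with next eq
  ... | x , refl , eq′ = under x (link-x x a w a<x) (link-a x a w) a<b b<x
      (trace-cong (λ { y (inj₁ x<y) → link-other x a w (≢-sym (FinP.<⇒≢ x<y)) (≢-sym (FinP.<⇒≢ (ℕP.<-trans a<x x<y)))
                     ; y (inj₂ (here refl)) → link-other x a w (FinP.<⇒≢ b<x) (≢-sym (FinP.<⇒≢ a<b))
                     ; y (inj₂ (there y∈))  → link-other x a w (FinP.<⇒≢ (Allᵛ.lookup below y∈)) (FinP.<⇒≢ (Allᵛ.lookup a> y∈)) })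
        (build-trace (b ∷ st) π eq′ (ℕP.m<n⇒m<1+n b<x ∷ raise below) (b> ∷ dec)))
    where w = build (b ∷ st) π eq′

  trace-matching : ∀ {v : Fin N → Fin N} {f n h m p} {st : Vec (Fin N) h} {π : Path f n h m} →
                   Trace v p st π → ∀ y → Remaining p st y → v y ≢ y × v (v y) ≡ y
  trace-matching done y (inj₁ N≤y) = contradiction (FinP.toℕ<n y) (ℕP.≤⇒≯ N≤y)
  trace-matching (up x _ tr) y (inj₂ y∈) = trace-matching tr y (inj₂ (there y∈))
  trace-matching (up x _ tr) y (inj₁ x≤y) with ≤⇒≡∨< x≤y
  ... | inj₁ refl = trace-matching tr y (inj₂ (here refl))
  ... | inj₂ x<y  = trace-matching tr y (inj₁ x<y)
  trace-matching (top x refl e a<x tr) y (inj₂ (here refl)) rewrite e = ≢-sym (FinP.<⇒≢ a<x) , refl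
  trace-matching (top x e e′ a<x tr) y (inj₂ (there y∈)) = trace-matching tr y (inj₂ y∈)
  trace-matching (top x e e′ a<x tr) y (inj₁ x≤y) with ≤⇒≡∨< x≤y
  trace-matching (top x refl e′ a<x tr) y (inj₁ x≤y) | inj₁ refl = FinP.<⇒≢ a<x , e′
  ... | inj₂ x<y = trace-matching tr y (inj₁ x<y)
  trace-matching (stay tr) y r = trace-matching tr y r
  trace-matching (under x e e′ a<b b<x tr) y (inj₂ (here refl)) = trace-matching tr y (inj₂ (here refl))
  trace-matching (under x refl e a<b b<x tr) y (inj₂ (there (here refl))) rewrite e =
    ≢-sym (FinP.<⇒≢ (ℕP.<-trans a<b b<x)) , refl
  trace-matching (under x e e′ a<b b<x tr) y (inj₂ (there (there y∈))) = trace-matching tr y (inj₂ (there y∈))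
  trace-matching (under x e e′ a<b b<x tr) y (inj₁ x≤y) with ≤⇒≡∨< x≤y
  trace-matching (under x refl e′ a<b b<x tr) y (inj₁ x≤y) | inj₁ refl = FinP.<⇒≢ (ℕP.<-trans a<b b<x) , e′
  ... | inj₂ x<y = trace-matching tr y (inj₁ x<y)

  -- By `complete` no open edge is missing from the stack; this locates the second edge of a
  -- crossing at the moment when the first one closes.
  record Stack (v : Fin N → Fin N) {h} (p : ℕ) (st : Vec (Fin N) h) : Set where
    constructor stack
    field
      below      : Below p st
      decreasing : Decreasing st
      complete   : ∀ y → toℕ y ℕ.< p → p ℕ.≤ toℕ (v y) → y ∈ᵛ st

  stack-up : ∀ {v h x} {st : Vec (Fin N) h} → Stack v (toℕ x) st → Stack v (suc (toℕ x)) (x ∷ st)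
  stack-up {v} {x = x} {st} (stack bel dec com) = stack (ℕP.≤-refl ∷ raise bel) (bel ∷ dec) com′
    where
    com′ : ∀ y → toℕ y ℕ.< suc (toℕ x) → suc (toℕ x) ℕ.≤ toℕ (v y) → y ∈ᵛ x ∷ st
    com′ y (s≤s y≤x) x<vy with ≤⇒≡∨< y≤x
    ... | inj₁ refl = here refl
    ... | inj₂ y<x  = there (com y y<x (ℕP.<⇒≤ x<vy))

  stack-top : ∀ {v h x a} {st : Vec (Fin N) h} → v x ≡ a → v a ≡ x → a Fin.< x →
              Stack v (toℕ x) (a ∷ st) → Stack v (suc (toℕ x)) st
  stack-top {v} {x = x} {st = st} refl e a<x (stack (_ ∷ bel) (_ ∷ dec) com) = stack (raise bel) dec com′
    where
    com′ : ∀ y → toℕ y ℕ.< suc (toℕ x) → suc (toℕ x) ℕ.≤ toℕ (v y) → y ∈ᵛ st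
    com′ y (s≤s y≤x) x<vy with ≤⇒≡∨< y≤x
    ... | inj₁ refl = contradiction a<x (ℕP.<-asym x<vy)
    ... | inj₂ y<x with com y y<x (ℕP.<⇒≤ x<vy)
    ...   | here refl rewrite e = contradiction x<vy (ℕP.<-irrefl refl)
    ...   | there y∈ = y∈

  stack-under : ∀ {v h x a b} {st : Vec (Fin N) h} → v x ≡ a → v a ≡ x → a Fin.< x →
                Stack v (toℕ x) (b ∷ a ∷ st) → Stack v (suc (toℕ x)) (b ∷ st)
  stack-under {v} {x = x} {b = b} {st} refl e a<x (stack (b<x ∷ _ ∷ bel) ((_ ∷ b>) ∷ (_ ∷ dec)) com) =
    stack (raise (b<x ∷ bel)) (b> ∷ dec) com′
    where
    com′ : ∀ y → toℕ y ℕ.< suc (toℕ x) → suc (toℕ x) ℕ.≤ toℕ (v y) → y ∈ᵛ b ∷ st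
    com′ y (s≤s y≤x) x<vy with ≤⇒≡∨< y≤x
    ... | inj₁ refl = contradiction a<x (ℕP.<-asym x<vy)
    ... | inj₂ y<x with com y y<x (ℕP.<⇒≤ x<vy)
    ...   | here refl = here refl
    ...   | there (here refl) rewrite e = contradiction x<vy (ℕP.<-irrefl refl)
    ...   | there (there y∈) = there y∈

-- Crossings along a trace

module _ {N : ℕ} where

  -- At an `under` step the edge of `a` closes while that of `b`, opened later, stays open, so the
  -- two cross. Closing the top edge adds no pair, as all edges still open began earlier.
  pairs : ∀ {v : Fin N → Fin N} {f n h m p} {st : Vec (Fin N) h} {π : Path f n h m} →
          Trace v p st π → List (Fin N × Fin N)
  pairs done                           = []
  pairs (up _ _ tr)                    = pairs tr
  pairs (top _ _ _ _ tr)               = pairs tr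
  pairs (stay tr)                      = pairs tr
  pairs (under {a = a} {b} _ _ _ _ _ tr) = (a , b) ∷ pairs tr

  length-pairs : ∀ {v : Fin N → Fin N} {f n h m p} {st : Vec (Fin N) h} {π : Path f n h m} →
                 (tr : Trace v p st π) → length (pairs tr) ≡ m
  length-pairs done                 = refl
  length-pairs (up _ _ tr)          = length-pairs tr
  length-pairs (top _ _ _ _ tr)     = length-pairs tr
  length-pairs (stay tr)            = length-pairs tr
  length-pairs (under _ _ _ _ _ tr) = cong suc (length-pairs tr)

  Crossing : (Fin N → Fin N) → Fin N → Fin N → Set
  Crossing v i j = (i Fin.< j) × (j Fin.< v i) × (v i Fin.< v j)

  -- These ask whether an opener lies between the top of the stack and `p`. They are expressed
  -- through `v` alone because such an opener serves as the `k` of a barred crossing if an edge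
  -- below the top closes next.
  Fresh Stale : (Fin N → Fin N) → ∀ {h} → ℕ → Vec (Fin N) h → Set
  Fresh v p []       = ⊤
  Fresh v p (b ∷ st) = ∀ k → b Fin.< k → toℕ k ℕ.< p → ¬ k Fin.< v k
  Stale v p []       = ⊤
  Stale v p (b ∷ st) = Σ[ k ∈ Fin N ] (b Fin.< k) × (toℕ k ℕ.< p) × (k Fin.< v k)

  fresh-up : ∀ {v h x} {st : Vec (Fin N) h} → Fresh v (suc (toℕ x)) (x ∷ st)
  fresh-up k x<k (s≤s k≤x) _ = ℕP.<⇒≱ x<k k≤x

  fresh-under : ∀ {v h h′ x b} {st : Vec (Fin N) h} {st′ : Vec (Fin N) h′} → v x Fin.< x →
                Fresh v (toℕ x) (b ∷ st) → Fresh v (suc (toℕ x)) (b ∷ st′)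
  fresh-under vx<x fresh k b<k (s≤s k≤x) with ≤⇒≡∨< k≤x
  ... | inj₁ refl = ℕP.<-asym vx<x
  ... | inj₂ k<x  = fresh k b<k k<x

  FreshIf : Bool → (Fin N → Fin N) → ∀ {h} → ℕ → Vec (Fin N) h → Set
  FreshIf true  v p st = Fresh v p st
  FreshIf false v p st = ⊤

  -- The bound on `v i` reflects that pairs are listed in the order of their first closers, which
  -- yields `pairs-unique`. The last clause is the absence of a bar and comes from freshness at the
  -- `under` step.
  pairs-sound : ∀ {v : Fin N → Fin N} {f n h m p} {st : Vec (Fin N) h} {π : Path f n h m} →
    FreshIf f v p st → (tr : Trace v p st π) →
    Allˡ (λ (i , j) → p ℕ.≤ toℕ (v i) × Crossing v i j × (∀ k → j Fin.< k → k Fin.< v i → ¬ k Fin.< v k)) (pairs tr)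
  pairs-sound _ done                 = []
  pairs-sound {v} {st = st} _ (up x _ tr) =
    Allˡ.map (λ (l , r) → ℕP.<⇒≤ l , r) (pairs-sound (fresh-up {v} {x = x} {st}) tr)
  pairs-sound _ (top x _ _ _ tr)     = Allˡ.map (λ (l , r) → ℕP.<⇒≤ l , r) (pairs-sound tt tr)
  pairs-sound _ (stay tr)            = pairs-sound tt tr
  pairs-sound {v} fresh (under {a = a} {b} {st} x refl e a<b b<x tr) =
    (ℕP.≤-reflexive (cong toℕ (sym e)) ,
     (a<b , subst (b Fin.<_) (sym e) b<x , subst (Fin._< v b) (sym e) (trace-late tr (here refl))) ,
     λ k b<k k<va → fresh k b<k (subst (k Fin.<_) e k<va))
    ∷ Allˡ.map (λ (l , r) → ℕP.<⇒≤ l , r)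
        (pairs-sound (fresh-under {v} {x = x} {b} {a ∷ st} {st} (ℕP.<-trans a<b b<x) fresh) tr)

  pairs-unique : ∀ {v : Fin N → Fin N} {f n h m p} {st : Vec (Fin N) h} {π : Path f n h m} →
                 FreshIf f v p st → (tr : Trace v p st π) → Unique (pairs tr)
  pairs-unique _ done             = []
  pairs-unique {v} {st = st} _ (up x _ tr) = pairs-unique (fresh-up {v} {x = x} {st}) tr
  pairs-unique _ (top x _ _ _ tr) = pairs-unique tt tr
  pairs-unique _ (stay tr)        = pairs-unique tt tr
  pairs-unique {v} fresh (under {a = a} {b} {st} x refl e a<b b<x tr) =
    Allˡ.map (λ { (x<vi , _) refl → ℕP.<-irrefl refl (subst (λ y → suc (toℕ x) ℕ.≤ toℕ y) e x<vi) }) (pairs-sound fresh′ tr)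
    ∷ pairs-unique fresh′ tr
    where
    fresh′ : Fresh v (suc (toℕ x)) (b ∷ st)
    fresh′ = fresh-under {v} {x = x} {b} {a ∷ st} {st} (ℕP.<-trans a<b b<x) fresh

  module _ {v : Fin N → Fin N} (inv : ∀ y → v (v y) ≡ y) where

    -- When `v i` is read, `j` is still open and hence on the stack. The entries below `i` began
    -- before `i`, so `j` lies above it; this rules out a `top` step and leaves only the top entry
    -- at an `under` step.
    pairs-complete : ∀ {f n h m p} {st : Vec (Fin N) h} {π : Path f n h m} →
      Stack v p st → (tr : Trace v p st π) → ∀ {i j} → Crossing v i j → p ℕ.≤ toℕ (v i) → (i , j) ∈ pairs tr
    pairs-complete S done {i} _ N≤vi = contradiction (FinP.toℕ<n (v i)) (ℕP.≤⇒≯ N≤vi)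
    pairs-complete S (up x x<vx tr) {i} cr@(i<j , j<vi , _) x≤vi with ≤⇒≡∨< x≤vi
    ... | inj₁ refl = contradiction (subst (v i Fin.<_) (inv i) x<vx) (ℕP.<-asym (ℕP.<-trans i<j j<vi))
    ... | inj₂ x<vi = pairs-complete (stack-up S) tr cr x<vi
    pairs-complete S@(stack _ (a> ∷ _) com) (top x refl e a<x tr) {i} {j} cr@(i<j , j<vi , vi<vj) x≤vi with ≤⇒≡∨< x≤vi
    ... | inj₂ x<vi = pairs-complete (stack-top refl e a<x S) tr cr x<vi
    ... | inj₁ refl with com j j<vi (ℕP.<⇒≤ vi<vj)
    ...   | here j≡   = contradiction i<j (ℕP.<-irrefl (cong toℕ (trans (sym (inv i)) (sym j≡))))
    ...   | there j∈  = contradiction i<j (ℕP.<-asym (subst (j Fin.<_) (inv i) (Allᵛ.lookup a> j∈)))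
    pairs-complete S (stay tr) cr p≤vi = pairs-complete S tr cr p≤vi
    pairs-complete S@(stack _ (_ ∷ a> ∷ _) com) (under x refl e a<b b<x tr) {i} {j} cr@(i<j , j<vi , vi<vj) x≤vi with ≤⇒≡∨< x≤vi
    ... | inj₂ x<vi = thereˡ (pairs-complete (stack-under refl e (ℕP.<-trans a<b b<x) S) tr cr x<vi)
    ... | inj₁ refl with com j j<vi (ℕP.<⇒≤ vi<vj)
    ...   | here refl          = hereˡ (cong (_, j) (sym (inv i)))
    ...   | there (here j≡)    = contradiction i<j (ℕP.<-irrefl (cong toℕ (trans (sym (inv i)) (sym j≡))))
    ...   | there (there j∈)   = contradiction i<j (ℕP.<-asym (subst (j Fin.<_) (inv i) (Allᵛ.lookup a> j∈)))

    -- From matchings to paths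

    Opened : ∀ {h} → ℕ → Vec (Fin N) h → Set
    Opened p st = ∀ {c} → c ∈ᵛ st → p ℕ.≤ toℕ (v c)

    later : ∀ {x c} → c ≢ v x → x Fin.≤ v c → x Fin.< v c
    later {c = c} c≢vx x≤vc with ≤⇒≡∨< x≤vc
    ... | inj₁ refl = contradiction (sym (inv c)) c≢vx
    ... | inj₂ x<vc = x<vc

    -- The opener of the edge just closed lies after the new top and is the witness.
    stale-top : ∀ {h x} (st : Vec (Fin N) h) → Stack v (toℕ x) (v x ∷ st) → v x Fin.< x → Stale v (suc (toℕ x)) st
    stale-top [] S vx<x = tt
    stale-top {x = x} (c ∷ st) (stack _ ((c<vx ∷ _) ∷ _) _) vx<x =
      v x , c<vx , ℕP.m<n⇒m<1+n vx<x , subst (v x Fin.<_) (sym (inv x)) vx<x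

    module _ (no-fix : ∀ y → v y ≢ y)
             (no-barred : ∀ {i j k} → i Fin.< j → j Fin.< k → k Fin.< v i → v i Fin.< v j → ¬ k Fin.< v k) where

      -- If `x` closes an edge lying below `b` on the stack, this edge crosses that of `b`, and an
      -- opener between `b` and `x` would bar the crossing.
      blocked : ∀ {x b k} → v x Fin.< b → x Fin.≤ v b → b Fin.< k → k Fin.< x → ¬ k Fin.< v k
      blocked {x} {b} {k} vx<b x≤vb b<k k<x = no-barred vx<b b<k
        (subst (k Fin.<_) (sym (inv x)) k<x)
        (subst (Fin._< v b) (sym (inv x)) (later (≢-sym (FinP.<⇒≢ vx<b)) x≤vb))

      -- The numbers of edges and crossings are left open here; they are identified afterwards, from
      -- the length of the reading and from `crossings`.
      Readable : Bool → ∀ {h} → ℕ → Vec (Fin N) h → Set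
      Readable f {h} p st = ∃[ n ] ∃[ m ] Σ[ π ∈ Path f n h m ] Trace v p st π

      readable-stay : ∀ {h p} {st : Vec (Fin N) (suc h)} → Readable false p st → Readable true p st
      readable-stay (n , m , π , tr) = n , m , stay π , stay tr

      mutual
        readable-stale : ∀ r {h p} (st : Vec (Fin N) h) → p ℕ.+ r ≡ N →
                         Stack v p st → Opened p st → Stale v p st → Readable false p st
        readable-stale zero {p = p} st eq S op _ with trans (sym (ℕP.+-identityʳ p)) eq
        readable-stale zero []       eq S op _ | refl = 0 , 0 , done , done
        readable-stale zero (b ∷ st) eq S op _ | refl = contradiction (FinP.toℕ<n (v b)) (ℕP.≤⇒≯ (op (here refl)))
        readable-stale (suc r) st eq S op stale with next eq
        ... | x , refl , eq′ with FinP.<-cmp x (v x)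
        ...   | tri≈ _ e _    = contradiction (sym e) (no-fix x)
        ...   | tri< x<vx _ _ = readable-up r st eq′ S op x<vx
        ...   | tri> _ _ vx<x = stale-close r st eq′ S op stale vx<x
                                  (Stack.complete S (v x) vx<x (ℕP.≤-reflexive (cong toℕ (sym (inv x)))))

        readable-fresh : ∀ r {h p} (st : Vec (Fin N) (suc h)) → p ℕ.+ r ≡ N →
                         Stack v p st → Opened p st → Fresh v p st → Readable true p st
        readable-fresh zero {p = p} (b ∷ st) eq S op _ =
          contradiction (FinP.toℕ<n (v b)) (ℕP.≤⇒≯ (subst (ℕ._≤ toℕ (v b)) (trans (sym (ℕP.+-identityʳ p)) eq) (op (here refl))))
        readable-fresh (suc r) st eq S op fresh with next eq
        ... | x , refl , eq′ with FinP.<-cmp x (v x)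
        ...   | tri≈ _ e _    = contradiction (sym e) (no-fix x)
        ...   | tri< x<vx _ _ = readable-stay (readable-up r st eq′ S op x<vx)
        ...   | tri> _ _ vx<x = fresh-close r st eq′ S op fresh vx<x
                                  (Stack.complete S (v x) vx<x (ℕP.≤-reflexive (cong toℕ (sym (inv x)))))

        stale-close : ∀ r {h x} (st : Vec (Fin N) h) → suc (toℕ x) ℕ.+ r ≡ N →
                      Stack v (toℕ x) st → Opened (toℕ x) st → Stale v (toℕ x) st →
                      v x Fin.< x → v x ∈ᵛ st → Readable false (toℕ x) st
        stale-close r (b ∷ st) eq S op _ vx<x (here refl) = readable-top r eq S op vx<x
        -- For an edge below the top, the opener `k` provided by staleness bars its crossing with
        -- the top edge.
        stale-close r (b ∷ st) eq (stack _ (b> ∷ _) _) op (k , b<k , k<x , k<vk) vx<x (there vx∈) =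
          contradiction k<vk (blocked (Allᵛ.lookup b> vx∈) (op (here refl)) b<k k<x)

        fresh-close : ∀ r {h x} (st : Vec (Fin N) (suc h)) → suc (toℕ x) ℕ.+ r ≡ N →
                      Stack v (toℕ x) st → Opened (toℕ x) st → Fresh v (toℕ x) st →
                      v x Fin.< x → v x ∈ᵛ st → Readable true (toℕ x) st
        fresh-close r (b ∷ st) eq S op _ vx<x (here refl) = readable-stay (readable-top r eq S op vx<x)
        fresh-close r {x = x} (b ∷ a ∷ st) eq S@(stack (b<x ∷ _) ((a<b ∷ _) ∷ a> ∷ _) _) op fresh vx<x (there (here refl)) =
          let n , m , π , tr = readable-fresh r (b ∷ st) eq (stack-under refl (inv x) vx<x S) op′
                                 (fresh-under {v} {x = x} {b} {a ∷ st} {st} vx<x fresh)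
          in n , suc m , under π , under x refl (inv x) a<b b<x tr
          where
          op′ : Opened (suc (toℕ x)) (b ∷ st)
          op′ (here refl) = later (≢-sym (FinP.<⇒≢ a<b)) (op (here refl))
          op′ (there c∈)  = later (FinP.<⇒≢ (Allᵛ.lookup a> c∈)) (op (there (there c∈)))
        -- For an edge at least two places below the top, the top `b` itself bars its crossing with
        -- the edge of `a`.
        fresh-close r {x = x} (b ∷ a ∷ st) eq (stack (b<x ∷ _) ((a<b ∷ _) ∷ a> ∷ _) _) op _ vx<x (there (there vx∈)) =
          contradiction (ℕP.<-≤-trans b<x (op (here refl)))
            (blocked (Allᵛ.lookup a> vx∈) (op (there (here refl))) a<b b<x)

        readable-up : ∀ r {h x} (st : Vec (Fin N) h) → suc (toℕ x) ℕ.+ r ≡ N →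
                      Stack v (toℕ x) st → Opened (toℕ x) st → x Fin.< v x → Readable false (toℕ x) st
        readable-up r {x = x} st eq S op x<vx =
          let n , m , π , tr = readable-fresh r (x ∷ st) eq (stack-up S) op′ (fresh-up {v} {x = x} {st})
          in suc n , m , up π , up x x<vx tr
          where
          op′ : Opened (suc (toℕ x)) (x ∷ st)
          op′ (here refl) = x<vx
          op′ (there c∈)  = later (FinP.<⇒≢ (ℕP.<-trans (Allᵛ.lookup (Stack.below S) c∈) x<vx)) (op c∈)

        readable-top : ∀ r {h x} {st : Vec (Fin N) h} → suc (toℕ x) ℕ.+ r ≡ N →
                       Stack v (toℕ x) (v x ∷ st) → Opened (toℕ x) (v x ∷ st) → v x Fin.< x →
                       Readable false (toℕ x) (v x ∷ st)
        readable-top r {x = x} {st} eq S@(stack _ (a> ∷ _) _) op vx<x =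
          let n , m , π , tr = readable-stale r st eq (stack-top refl (inv x) vx<x S)
                                 (λ c∈ → later (FinP.<⇒≢ (Allᵛ.lookup a> c∈)) (op (there c∈)))
                                 (stale-top st S vx<x)
          in n , m , top π , top x refl (inv x) vx<x tr

-- Enumeration of the paths

mutual
  stalePaths : ∀ n h m → List (Path false n h m)
  stalePaths zero    zero    zero    = done ∷ []
  stalePaths zero    zero    (suc m) = []
  stalePaths zero    (suc h) m       = map top (stalePaths zero h m)
  stalePaths (suc n) zero    m       = map up (freshPaths n zero m)
  stalePaths (suc n) (suc h) m       = map up (freshPaths n (suc h) m) ++ map top (stalePaths (suc n) h m)

  -- The index `h` means `suc h` open edges, because a fresh state always has a top edge; this is
  -- the indexing of `b` and `T`.
  freshPaths : ∀ n h m → List (Path true n (suc h) m)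
  freshPaths n zero    m       = map stay (stalePaths n 1 m)
  freshPaths n (suc h) zero    = map stay (stalePaths n (suc (suc h)) zero)
  freshPaths n (suc h) (suc m) = map stay (stalePaths n (suc (suc h)) (suc m)) ++ map under (freshPaths n h m)

mutual
  ∈-stalePaths : ∀ {n h m} (π : Path false n h m) → π ∈ stalePaths n h m
  ∈-stalePaths done = hereˡ refl
  ∈-stalePaths (up {h = zero} π)   = ∈-map⁺ up (∈-freshPaths π)
  ∈-stalePaths (up {h = suc h} π)  = ∈-++⁺ˡ (∈-map⁺ up (∈-freshPaths π))
  ∈-stalePaths (top {n = zero} π)  = ∈-map⁺ top (∈-stalePaths π)
  ∈-stalePaths (top {n = suc n} {h} {m} π) = ∈-++⁺ʳ (map up (freshPaths n (suc h) m)) (∈-map⁺ top (∈-stalePaths π))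

  ∈-freshPaths : ∀ {n h m} (π : Path true n (suc h) m) → π ∈ freshPaths n h m
  ∈-freshPaths {h = zero}                (stay π)  = ∈-map⁺ stay (∈-stalePaths π)
  ∈-freshPaths {h = suc h} {zero}        (stay π)  = ∈-map⁺ stay (∈-stalePaths π)
  ∈-freshPaths {h = suc h} {suc m}       (stay π)  = ∈-++⁺ˡ (∈-map⁺ stay (∈-stalePaths π))
  ∈-freshPaths {n} {suc h} {suc m}       (under π) =
    ∈-++⁺ʳ (map stay (stalePaths n (suc (suc h)) (suc m))) (∈-map⁺ under (∈-freshPaths π))

map-disjoint : ∀ {A B C : Set} {f : A → C} {g : B → C} {xs ys} → (∀ {x y} → f x ≢ g y) → Disjoint (map f xs) (map g ys)
map-disjoint {f = f} {g} f≢g (∈xs , ∈ys) =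
  let _ , _ , e = ∈-map⁻ f ∈xs ; _ , _ , e′ = ∈-map⁻ g ∈ys in f≢g (trans (sym e) e′)

mutual
  stalePaths-unique : ∀ n h m → Unique (stalePaths n h m)
  stalePaths-unique zero    zero    zero    = [] ∷ []
  stalePaths-unique zero    zero    (suc m) = []
  stalePaths-unique zero    (suc h) m       = Unique.map⁺ (λ { refl → refl }) (stalePaths-unique zero h m)
  stalePaths-unique (suc n) zero    m       = Unique.map⁺ (λ { refl → refl }) (freshPaths-unique n zero m)
  stalePaths-unique (suc n) (suc h) m       =
    Unique.++⁺ (Unique.map⁺ (λ { refl → refl }) (freshPaths-unique n (suc h) m))
               (Unique.map⁺ (λ { refl → refl }) (stalePaths-unique (suc n) h m)) (map-disjoint λ ())

  freshPaths-unique : ∀ n h m → Unique (freshPaths n h m)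
  freshPaths-unique n zero    m       = Unique.map⁺ (λ { refl → refl }) (stalePaths-unique n 1 m)
  freshPaths-unique n (suc h) zero    = Unique.map⁺ (λ { refl → refl }) (stalePaths-unique n (suc (suc h)) zero)
  freshPaths-unique n (suc h) (suc m) =
    Unique.++⁺ (Unique.map⁺ (λ { refl → refl }) (stalePaths-unique n (suc (suc h)) (suc m)))
               (Unique.map⁺ (λ { refl → refl }) (freshPaths-unique n h m)) (map-disjoint λ ())

-- The bijection between paths and avoiding matchings

length-unique : ∀ {A : Set} {xs ys : List A} → Unique xs → Unique ys →
                (∀ {x} → x ∈ xs → x ∈ ys) → (∀ {x} → x ∈ ys → x ∈ xs) → length xs ≡ length ys
length-unique u u′ to from = ↭-length (∼bag⇒↭ (unique∧set⇒bag u u′ (mk⇔ to from)))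

module _ {N : ℕ} (v : Vec (Fin N) N) where

  stack-[] : Stack (lookup v) 0 []
  stack-[] = stack [] [] (λ _ ())

  trace⇒matching : ∀ {n m} {π : Path false n 0 m} → Trace (lookup v) 0 [] π → IsMatching v
  trace⇒matching tr y = trace-matching tr y (inj₁ z≤n)

  trace⇒avoids : ∀ {n m} {π : Path false n 0 m} → Trace (lookup v) 0 [] π → Avoids v p12312
  trace⇒avoids tr = ¬barred⇒avoids λ (i<j , j<k , k<vi , vi<vj , k<vk) →
    let ij∈ = pairs-complete involutive stack-[] tr (i<j , ℕP.<-trans j<k k<vi , vi<vj) z≤n
        _ , _ , no-opener = Allˡ.lookup (pairs-sound tt tr) ij∈
    in no-opener _ j<k k<vi k<vk
    where open Labels v (trace⇒matching tr)

  trace⇒crossings : ∀ {n m} {π : Path false n 0 m} → Trace (lookup v) 0 [] π → crossings v ≡ m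
  trace⇒crossings tr = trans
    (length-unique (Unique.filter⁺ _ (Unique.cartesianProduct⁺ (Unique.allFin⁺ N) (Unique.allFin⁺ N)))
      (pairs-unique tt tr)
      (λ ij∈ → pairs-complete involutive stack-[] tr
        (proj₂ (∈-filter⁻ _ {xs = cartesianProduct (allFin N) (allFin N)} ij∈)) z≤n)
      (λ {(i , j)} ij∈ → ∈-filter⁺ _ (∈-cartesianProduct⁺ (∈-allFin i) (∈-allFin j))
                           (proj₁ (proj₂ (Allˡ.lookup (pairs-sound tt tr) ij∈)))))
    (length-pairs tr)
    where open Labels v (trace⇒matching tr)

  avoids⇒trace : IsMatching v → Avoids v p12312 → ∃[ n ] ∃[ m ] Σ[ π ∈ Path false n 0 m ] Trace (lookup v) 0 [] π
  avoids⇒trace M avoids = readable-stale involutive (λ y → proj₁ (M y))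
    (λ i<j j<k k<vi vi<vj k<vk → avoids⇒¬barred avoids (i<j , j<k , k<vi , vi<vj , k<vk))
    N [] refl stack-[] (λ ()) tt
    where open Labels v M

trace-size : ∀ {N f n h m p} {v : Fin N → Fin N} {st : Vec (Fin N) h} {π : Path f n h m} →
             Trace v p st π → p ℕ.+ size π ≡ N
trace-size done = ℕP.+-identityʳ _
trace-size (up x _ tr) = trans (ℕP.+-suc (toℕ x) _) (trace-size tr)
trace-size (top x _ _ _ tr) = trans (ℕP.+-suc (toℕ x) _) (trace-size tr)
trace-size (stay tr) = trace-size tr
trace-size (under x _ _ _ _ tr) = trans (ℕP.+-suc (toℕ x) _) (trace-size tr)

module _ (n m : ℕ) where

  matching : Path false n 0 m → Vec (Fin (2 ℕ.* n)) (2 ℕ.* n)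
  matching π = build [] π (trans (size-≡ π) (ℕP.+-identityʳ (2 ℕ.* n)))

  matching-trace : ∀ π → Trace (lookup (matching π)) 0 [] π
  matching-trace π = build-trace [] π _ [] []

  matching-injective : ∀ {π π′} → matching π ≡ matching π′ → π ≡ π′
  matching-injective {π} {π′} e =
    trace-path-unique (matching-trace π) (subst (λ v → Trace (lookup v) 0 [] π′) (sym e) (matching-trace π′))

  trace⇒∈ : ∀ {v n′ m′} {π : Path false n′ 0 m′} → Trace (lookup v) 0 [] π → crossings v ≡ m →
            v ∈ map matching (stalePaths n 0 m)
  trace⇒∈ {v} {n′} {π = π} tr e
    -- The crossings identify `m′` with `m`, and the length of the trace gives 2 n′ = 2 n.
    with trans (sym (trace⇒crossings v tr)) e
       | ℕP.*-cancelˡ-≡ n′ n 2 (trans (sym (trans (size-≡ π) (ℕP.+-identityʳ (2 ℕ.* n′)))) (trace-size tr))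
  ... | refl | refl = subst (_∈ map matching (stalePaths n 0 m)) (sym v≡) (∈-map⁺ matching (∈-stalePaths π))
    where
    v≡ : v ≡ matching π
    v≡ = lookup-injective (λ y → trace-determines tr (matching-trace π) y (inj₁ z≤n))
      where
      lookup-injective : ∀ {N k} {v w : Vec (Fin N) k} → (∀ y → lookup v y ≡ lookup w y) → v ≡ w
      lookup-injective {v = v} {w} e = trans (sym (VecP.tabulate∘lookup v))
        (trans (VecP.tabulate-cong e) (VecP.tabulate∘lookup w))

  count12312-paths : count12312 n m ≡ length (stalePaths n 0 m)
  count12312-paths = trans
    (length-unique (Unique.filter⁺ _ (allVecs-unique (2 ℕ.* n) (2 ℕ.* n)))
                   (Unique.map⁺ matching-injective (stalePaths-unique n 0 m)) to from)
    (length-map matching (stalePaths n 0 m))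
    where
    to : ∀ {v} → v ∈ filter _ (allVecs (2 ℕ.* n) (2 ℕ.* n)) → v ∈ map matching (stalePaths n 0 m)
    to {v} v∈ =
      let M , avoids , e = proj₂ (∈-filter⁻ _ {xs = allVecs (2 ℕ.* n) (2 ℕ.* n)} v∈)
          _ , _ , _ , tr = avoids⇒trace v M avoids
      in trace⇒∈ tr e
    from : ∀ {v} → v ∈ map matching (stalePaths n 0 m) → v ∈ filter _ (allVecs (2 ℕ.* n) (2 ℕ.* n))
    from v∈ with ∈-map⁻ matching v∈
    ... | π , _ , refl = ∈-filter⁺ _ (∈-allVecs (matching π))
      (trace⇒matching v (matching-trace π) , trace⇒avoids v (matching-trace π) , trace⇒crossings v (matching-trace π))
      where
      v : Vec (Fin (2 ℕ.* n)) (2 ℕ.* n)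
      v = matching π

-- Evaluation of the count in ℤ⟦q⟧ and ℚ

open ≡-Reasoning

-- ℤ⟦q⟧ is the ring of power series in a variable q that marks the crossings.
module ℤ⟦q⟧ = CommutativeRing (PowerSeries.seriesRing ℤP.+-*-commutativeRing)
open PowerSeries ℤP.+-*-commutativeRing using (_⊛_; z-⊛; const; ⊛-distribʳ)
  renaming (z to q; Σ≤ to Σℤ≤; Σ≤-cong to Σℤ≤-cong)
open PowerSeries (PowerSeries.seriesRing ℤP.+-*-commutativeRing) using (Σ≤)
module L = Lagrange (PowerSeries.seriesRing ℤP.+-*-commutativeRing) (q ℤ⟦q⟧.- ℤ⟦q⟧.1#)
open Algebra.Properties.CommutativeMonoid.Mult ℤ⟦q⟧.+-commutativeMonoid using () renaming (_×_ to _·_)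
open import Algebra.Properties.CommutativeSemiring.Exp ℤ⟦q⟧.commutativeSemiring using (_^_)

t : ℕ → ℤ
t = q ℤ⟦q⟧.- ℤ⟦q⟧.1#

open Algebra.Properties.Ring ℤ⟦q⟧.ring using (-‿distribˡ-*)

sgn : ℕ → ℤ
sgn k = -[1+ 0 ] ℤ.^ k

·-coefficient : ∀ n x m → (n · x) m ≡ + n ℤ.* x m
·-coefficient zero    x m = refl
·-coefficient (suc n) x m = begin
  x m ℤ.+ (n · x) m          ≡⟨ cong (ℤ._+_ (x m)) (·-coefficient n x m) ⟩
  x m ℤ.+ + n ℤ.* x m        ≡⟨ ℤP.suc-* (+ n) (x m) ⟨
  + suc n ℤ.* x m            ∎

[1+t]-⊛ : ∀ f m → ((ℤ⟦q⟧.1# ℤ⟦q⟧.+ t) ⊛ f) m ≡ (q ⊛ f) m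
[1+t]-⊛ f = ℤ⟦q⟧.*-congʳ {f} {ℤ⟦q⟧.1# ℤ⟦q⟧.+ t} {q} λ k → lemma (ℤ⟦q⟧.1# k) (q k)
  where
  lemma : ∀ x y → x ℤ.+ (y ℤ.+ ℤ.- x) ≡ y
  lemma = ℤSolver.solve-∀

t-⊛ : ∀ f m → (t ⊛ f) m ≡ (q ⊛ f) m ℤ.+ ℤ.- f m
t-⊛ f m = begin
  (t ⊛ f) m                                  ≡⟨ ⊛-distribʳ f q (ℤ⟦q⟧.- ℤ⟦q⟧.1#) m ⟩
  (q ⊛ f) m ℤ.+ ((ℤ⟦q⟧.- ℤ⟦q⟧.1#) ⊛ f) m   ≡⟨ cong (ℤ._+_ ((q ⊛ f) m)) (-‿distribˡ-* ℤ⟦q⟧.1# f m) ⟨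
  (q ⊛ f) m ℤ.+ ℤ.- (ℤ⟦q⟧.1# ⊛ f) m        ≡⟨ cong (λ x → (q ⊛ f) m ℤ.+ ℤ.- x) (ℤ⟦q⟧.*-identityˡ f m) ⟩
  (q ⊛ f) m ℤ.+ ℤ.- f m                     ∎

-- The binomial theorem for (q - 1)^j. The exponent m + j has the parity of j - m and avoids
-- truncated subtraction; for m > j the binomial coefficient vanishes.
t-^ : ∀ j m → (t ^ j) m ≡ sgn (m ℕ.+ j) ℤ.* + (j C m)
t-^ zero    zero    = refl
t-^ zero    (suc m) = sym (trans
  (cong (λ c → sgn (suc m ℕ.+ 0) ℤ.* + c) (k>n⇒nCk≡0 {0} {suc m} (s≤s z≤n)))
  (ℤP.*-zeroʳ (sgn (suc m ℕ.+ 0))))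
t-^ (suc j) zero    = begin
  (t ⊛ t ^ j) 0                 ≡⟨ t-⊛ (t ^ j) 0 ⟩
  0ℤ ℤ.+ ℤ.- (t ^ j) 0          ≡⟨ cong (λ x → 0ℤ ℤ.+ ℤ.- x) (t-^ j 0) ⟩
  0ℤ ℤ.+ ℤ.- (sgn j ℤ.* 1ℤ)     ≡⟨ lemma (sgn j) ⟩
  -[1+ 0 ] ℤ.* sgn j ℤ.* 1ℤ     ∎
  where
  lemma : ∀ x → 0ℤ ℤ.+ ℤ.- (x ℤ.* 1ℤ) ≡ -[1+ 0 ] ℤ.* x ℤ.* 1ℤ
  lemma = ℤSolver.solve-∀
t-^ (suc j) (suc m) = begin
  (t ⊛ t ^ j) (suc m)
    ≡⟨ t-⊛ (t ^ j) (suc m) ⟩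
  (q ⊛ t ^ j) (suc m) ℤ.+ ℤ.- (t ^ j) (suc m)
    ≡⟨ cong₂ (λ x y → x ℤ.+ ℤ.- y) (trans (z-⊛ (t ^ j) m) (t-^ j m)) (t-^ j (suc m)) ⟩
  sgn (m ℕ.+ j) ℤ.* + (j C m) ℤ.+ ℤ.- (-[1+ 0 ] ℤ.* sgn (m ℕ.+ j) ℤ.* + (j C suc m))
    ≡⟨ lemma (sgn (m ℕ.+ j)) (+ (j C m)) (+ (j C suc m)) ⟩
  -[1+ 0 ] ℤ.* (-[1+ 0 ] ℤ.* sgn (m ℕ.+ j)) ℤ.* (+ (j C m) ℤ.+ + (j C suc m))
    ≡⟨ cong₂ (λ k c → -[1+ 0 ] ℤ.* sgn k ℤ.* + c) (sym (ℕP.+-suc m j)) (nCk+nC[k+1]≡[n+1]C[k+1] j m) ⟩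
  sgn (suc m ℕ.+ suc j) ℤ.* + (suc j C suc m) ∎
  where
  lemma : ∀ x y z → x ℤ.* y ℤ.+ ℤ.- (-[1+ 0 ] ℤ.* x ℤ.* z) ≡ -[1+ 0 ] ℤ.* (-[1+ 0 ] ℤ.* x) ℤ.* (y ℤ.+ z)
  lemma = ℤSolver.solve-∀

staleCount freshCount : ℕ → ℕ → ℕ → ℤ
staleCount n h m = + length (stalePaths n h m)
freshCount n h m = + length (freshPaths n h m)

torsion-free : ∀ n x → suc n · x ℤ⟦q⟧.≈ ℤ⟦q⟧.0# → x ℤ⟦q⟧.≈ ℤ⟦q⟧.0#
torsion-free n x nx≈0 m = ℤP.*-cancelˡ-≡ (+ suc n) (x m) 0ℤ
  (trans (sym (·-coefficient (suc n) x m)) (trans (nx≈0 m) (sym (ℤP.*-zeroʳ (+ suc n)))))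

stale-zero-zero : ∀ m → staleCount 0 0 m ≡ const 1ℤ m
stale-zero-zero zero    = refl
stale-zero-zero (suc m) = refl

stale-suc-suc : ∀ n h m → staleCount (suc n) (suc h) m ≡ freshCount n (suc h) m ℤ.+ staleCount (suc n) h m
stale-suc-suc n h m = cong +_ (trans (length-++ (map Path.up (freshPaths n (suc h) m)))
  (cong₂ ℕ._+_ (length-map Path.up (freshPaths n (suc h) m)) (length-map Path.top (stalePaths (suc n) h m))))

-- `under` is the one step that adds a crossing, whence the factor q = 1 + t.
fresh-suc : ∀ n h m → freshCount n (suc h) m ≡ staleCount n (suc (suc h)) m ℤ.+ ((ℤ⟦q⟧.1# ℤ⟦q⟧.+ t) ⊛ freshCount n h) m
fresh-suc n h m = trans (lemma m) (cong (ℤ._+_ (staleCount n (suc (suc h)) m)) (sym ([1+t]-⊛ (freshCount n h) m)))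
  where
  lemma : ∀ m → freshCount n (suc h) m ≡ staleCount n (suc (suc h)) m ℤ.+ (q ⊛ freshCount n h) m
  lemma zero    = trans (cong +_ (length-map Path.stay (stalePaths n (suc (suc h)) 0))) (sym (ℤP.+-identityʳ _))
  lemma (suc m) = trans
    (cong +_ (trans (length-++ (map Path.stay (stalePaths n (suc (suc h)) (suc m))))
      (cong₂ ℕ._+_ (length-map Path.stay (stalePaths n (suc (suc h)) (suc m))) (length-map Path.under (freshPaths n h m)))))
    (cong (ℤ._+_ (staleCount n (suc (suc h)) (suc m))) (sym (z-⊛ (freshCount n h) m)))

Σ≤-coefficient : ∀ k (f : ℕ → ℕ → ℤ) m → Σ≤ k f m ≡ Σℤ≤ k (λ j → f j m)
Σ≤-coefficient zero    f m = refl
Σ≤-coefficient (suc k) f m = cong (ℤ._+_ (f 0 m)) (Σ≤-coefficient k (f ∘ suc) m)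

summand : ℕ → ℕ → ℕ → ℤ
summand n m j = + (((n ℕ.+ j) C j) ℕ.* ((3 ℕ.* suc n) C (n ∸ j))) ℤ.* (sgn (m ℕ.+ j) ℤ.* + (j C m))

path-count : ∀ n m → + suc n ℤ.* staleCount (suc n) 0 m ≡ Σℤ≤ n (summand n m)
path-count n m = begin
  + suc n ℤ.* staleCount (suc n) 0 m
    ≡⟨ ·-coefficient (suc n) (staleCount (suc n) 0) m ⟨
  (suc n · staleCount (suc n) 0) m
    ≡⟨ L.Recurrence.closed-form torsion-free staleCount freshCount stale-zero-zero
         (λ h m → cong +_ (length-map Path.top (stalePaths 0 h m)))
         (λ n m → cong +_ (length-map Path.up (freshPaths n 0 m))) stale-suc-suc
         (λ n m → cong +_ (length-map Path.stay (stalePaths n 1 m))) fresh-suc n m ⟩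
  Σ≤ n (λ j → coef j · t ^ j) m
    ≡⟨ Σ≤-coefficient n (λ j → coef j · t ^ j) m ⟩
  Σℤ≤ n (λ j → (coef j · t ^ j) m)
    ≡⟨ Σℤ≤-cong n (λ j → trans (·-coefficient (coef j) (t ^ j) m) (cong (ℤ._*_ (+ coef j)) (t-^ j m))) ⟩
  Σℤ≤ n (summand n m) ∎
  where
  coef : ℕ → ℕ
  coef j = ((n ℕ.+ j) C j) ℕ.* ((3 ℕ.* suc n) C (n ∸ j))

-- From the integer identity to the rational sum

[1+k]*[1+n]C[1+k]≡[1+n]*nCk : ∀ n k → suc k ℕ.* (suc n C suc k) ≡ suc n ℕ.* (n C k)
[1+k]*[1+n]C[1+k]≡[1+n]*nCk zero    zero    = refl
[1+k]*[1+n]C[1+k]≡[1+n]*nCk zero    (suc k) = ℕP.*-zeroʳ (suc (suc k))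
[1+k]*[1+n]C[1+k]≡[1+n]*nCk (suc n) k = begin
  suc k ℕ.* (suc (suc n) C suc k)
    ≡⟨ cong (suc k ℕ.*_) (nCk+nC[k+1]≡[n+1]C[k+1] (suc n) k) ⟨
  suc k ℕ.* (suc n C k ℕ.+ suc n C suc k)
    ≡⟨ ℕP.*-distribˡ-+ (suc k) (suc n C k) (suc n C suc k) ⟩
  suc k ℕ.* (suc n C k) ℕ.+ suc k ℕ.* (suc n C suc k)
    ≡⟨ cong (suc k ℕ.* (suc n C k) ℕ.+_) ([1+k]*[1+n]C[1+k]≡[1+n]*nCk n k) ⟩
  suc k ℕ.* (suc n C k) ℕ.+ suc n ℕ.* (n C k)
    ≡⟨ step k ⟩
  suc (suc n) ℕ.* (suc n C k) ∎
  where
  rearrange : ∀ a b c d → a ℕ.+ b ℕ.* c ℕ.+ b ℕ.* d ≡ a ℕ.+ b ℕ.* (c ℕ.+ d)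
  rearrange = ℕSolver.solve-∀
  step : ∀ k → suc k ℕ.* (suc n C k) ℕ.+ suc n ℕ.* (n C k) ≡ suc (suc n) ℕ.* (suc n C k)
  step zero    = refl
  step (suc k) = begin
    suc n C suc k ℕ.+ suc k ℕ.* (suc n C suc k) ℕ.+ suc n ℕ.* (n C suc k)
      ≡⟨ cong (λ x → suc n C suc k ℕ.+ x ℕ.+ suc n ℕ.* (n C suc k)) ([1+k]*[1+n]C[1+k]≡[1+n]*nCk n k) ⟩
    suc n C suc k ℕ.+ suc n ℕ.* (n C k) ℕ.+ suc n ℕ.* (n C suc k)
      ≡⟨ rearrange (suc n C suc k) (suc n) (n C k) (n C suc k) ⟩
    suc n C suc k ℕ.+ suc n ℕ.* (n C k ℕ.+ n C suc k)
      ≡⟨ cong (λ x → suc n C suc k ℕ.+ suc n ℕ.* x) (nCk+nC[k+1]≡[n+1]C[k+1] n k) ⟩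
    suc (suc n) ℕ.* (suc n C suc k) ∎

/-cong : ∀ x m y n → x ℤ.* + suc n ≡ y ℤ.* + suc m → x / suc m ≡ y / suc n
/-cong x m y n e = ℚP.fromℚᵘ-cong {mkℚᵘ x m} {mkℚᵘ y n} (*≡* e)

/-+ : ∀ x y n → x / suc n ℚ.+ y / suc n ≡ (x ℤ.+ y) / suc n
/-+ x y n = ℚP.toℚᵘ-injective (begin-equality
  ℚ.toℚᵘ (x / suc n ℚ.+ y / suc n)                  ≃⟨ ℚP.toℚᵘ-homo-+ (x / suc n) (y / suc n) ⟩
  ℚ.toℚᵘ (x / suc n) ℚᵘ.+ ℚ.toℚᵘ (y / suc n)        ≃⟨ ℚᵘP.+-cong (ℚP.toℚᵘ-fromℚᵘ (mkℚᵘ x n)) (ℚP.toℚᵘ-fromℚᵘ (mkℚᵘ y n)) ⟩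
  mkℚᵘ x n ℚᵘ.+ mkℚᵘ y n                            ≃⟨ *≡* (trans (lemma x y (+ suc n))
                                                          (cong (ℤ._*_ (x ℤ.+ y)) (sym (ℤP.pos-* (suc n) (suc n))))) ⟩
  mkℚᵘ (x ℤ.+ y) n                                  ≃⟨ ℚP.toℚᵘ-fromℚᵘ (mkℚᵘ (x ℤ.+ y) n) ⟨
  ℚ.toℚᵘ ((x ℤ.+ y) / suc n)                        ∎′)
  where
  open ℚᵘP.≤-Reasoning renaming (_∎ to _∎′) using (begin-equality_; step-≃-⟩; step-≃-⟨)
  lemma : ∀ x y d → (x ℤ.* d ℤ.+ y ℤ.* d) ℤ.* d ≡ (x ℤ.+ y) ℤ.* (d ℤ.* d)
  lemma = ℤSolver.solve-∀

sumℚ-/ : ∀ n k (f : ℕ → ℚ) (g : ℕ → ℤ) → (∀ j → j ≤ k → f j ≡ g j / suc n) →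
         sumℚ (applyUpTo f (suc k)) ≡ Σℤ≤ k g / suc n
sumℚ-/ n zero    f g f≡g = trans (ℚP.+-identityʳ (f 0)) (f≡g 0 z≤n)
sumℚ-/ n (suc k) f g f≡g = trans
  (cong₂ ℚ._+_ (f≡g 0 z≤n) (sumℚ-/ n k (f ∘ suc) (g ∘ suc) (λ j j≤k → f≡g (suc j) (s≤s j≤k))))
  (/-+ (g 0) (Σℤ≤ k (g ∘ suc)) n)

sgn-even : ∀ n k → sgn (n ℕ.+ n ℕ.+ k) ≡ sgn k
sgn-even zero    k = refl
sgn-even (suc n) k = begin
  sgn (suc n ℕ.+ suc n ℕ.+ k)                    ≡⟨ cong (λ x → sgn (suc (x ℕ.+ k))) (ℕP.+-suc n n) ⟩
  -[1+ 0 ] ℤ.* (-[1+ 0 ] ℤ.* sgn (n ℕ.+ n ℕ.+ k)) ≡⟨ lemma (sgn (n ℕ.+ n ℕ.+ k)) ⟩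
  sgn (n ℕ.+ n ℕ.+ k)                            ≡⟨ sgn-even n k ⟩
  sgn k                                          ∎
  where
  lemma : ∀ x → -[1+ 0 ] ℤ.* (-[1+ 0 ] ℤ.* x) ≡ x
  lemma = ℤSolver.solve-∀

[n+j]Cn≡[n+j]Cj : ∀ n j → (n ℕ.+ j) C n ≡ (n ℕ.+ j) C j
[n+j]Cn≡[n+j]Cj n j = trans (nCk≡nC[n∸k] (ℕP.m≤m+n n j)) (cong ((n ℕ.+ j) C_) (ℕP.m+n∸m≡n n j))

-- With N = n + 1 and i = N + j, the absorption rule turns the binomial of i over N divided by i
-- into that of n + j over j divided by N, so that all terms get the common denominator N.
term-summand : ∀ n m j → j ≤ n → term (suc n) m (suc n ℕ.+ j) ≡ summand n m j / suc n
term-summand n m j j≤n = /-cong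
  (sgn (N ℕ.+ m ℕ.+ (N ℕ.+ j))
    ℤ.* + (((N ℕ.+ j) C N) ℕ.* ((3 ℕ.* N) C (N ℕ.+ j ℕ.+ 1 ℕ.+ N)) ℕ.* ((N ℕ.+ j ∸ N) C m)))
  (n ℕ.+ j) (summand n m j) n (begin
  sgn (N ℕ.+ m ℕ.+ (N ℕ.+ j)) ℤ.* + (((N ℕ.+ j) C N) ℕ.* ((3 ℕ.* N) C (N ℕ.+ j ℕ.+ 1 ℕ.+ N)) ℕ.* ((N ℕ.+ j ∸ N) C m)) ℤ.* + N
    ≡⟨ cong₂ (λ s c → s ℤ.* c ℤ.* + N) sign-eq
         (cong₂ (λ x y → + (((N ℕ.+ j) C N) ℕ.* x ℕ.* (y C m))) symmetric (ℕP.m+n∸m≡n N j)) ⟩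
  sgn (m ℕ.+ j) ℤ.* + (((N ℕ.+ j) C N) ℕ.* ((3 ℕ.* N) C (n ∸ j)) ℕ.* (j C m)) ℤ.* + N
    ≡⟨ pull (sgn (m ℕ.+ j)) ((N ℕ.+ j) C N) ((3 ℕ.* N) C (n ∸ j)) (j C m) N ⟩
  sgn (m ℕ.+ j) ℤ.* + (N ℕ.* ((N ℕ.+ j) C N) ℕ.* (((3 ℕ.* N) C (n ∸ j)) ℕ.* (j C m)))
    ≡⟨ cong (λ x → sgn (m ℕ.+ j) ℤ.* + (x ℕ.* (((3 ℕ.* N) C (n ∸ j)) ℕ.* (j C m))))
         (trans ([1+k]*[1+n]C[1+k]≡[1+n]*nCk (n ℕ.+ j) n) (cong ((N ℕ.+ j) ℕ.*_) ([n+j]Cn≡[n+j]Cj n j))) ⟩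
  sgn (m ℕ.+ j) ℤ.* + ((N ℕ.+ j) ℕ.* ((n ℕ.+ j) C j) ℕ.* (((3 ℕ.* N) C (n ∸ j)) ℕ.* (j C m)))
    ≡⟨ pull′ (sgn (m ℕ.+ j)) ((n ℕ.+ j) C j) ((3 ℕ.* N) C (n ∸ j)) (j C m) (N ℕ.+ j) ⟩
  summand n m j ℤ.* + (N ℕ.+ j) ∎)
  where
  N : ℕ
  N = suc n
  sign-eq : sgn (N ℕ.+ m ℕ.+ (N ℕ.+ j)) ≡ sgn (m ℕ.+ j)
  sign-eq = trans (cong sgn (lemma N m j)) (sgn-even N (m ℕ.+ j))
    where
    lemma : ∀ N m j → N ℕ.+ m ℕ.+ (N ℕ.+ j) ≡ N ℕ.+ N ℕ.+ (m ℕ.+ j)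
    lemma = ℕSolver.solve-∀
  total : N ℕ.+ j ℕ.+ 1 ℕ.+ N ℕ.+ (n ∸ j) ≡ 3 ℕ.* N
  total = trans (lemma n j (n ∸ j)) (trans (cong (λ x → suc n ℕ.+ 1 ℕ.+ suc n ℕ.+ x) (ℕP.m+[n∸m]≡n j≤n)) (lemma′ n))
    where
    lemma : ∀ n j d → suc n ℕ.+ j ℕ.+ 1 ℕ.+ suc n ℕ.+ d ≡ suc n ℕ.+ 1 ℕ.+ suc n ℕ.+ (j ℕ.+ d)
    lemma = ℕSolver.solve-∀
    lemma′ : ∀ n → suc n ℕ.+ 1 ℕ.+ suc n ℕ.+ n ≡ 3 ℕ.* suc n
    lemma′ = ℕSolver.solve-∀
  -- The lower indices 2 N + j + 1 and n - j are complementary in 3 N; this is where j ≤ n enters.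
  symmetric : (3 ℕ.* N) C (N ℕ.+ j ℕ.+ 1 ℕ.+ N) ≡ (3 ℕ.* N) C (n ∸ j)
  symmetric = subst (λ x → x C (N ℕ.+ j ℕ.+ 1 ℕ.+ N) ≡ x C (n ∸ j)) total ([n+j]Cn≡[n+j]Cj (N ℕ.+ j ℕ.+ 1 ℕ.+ N) (n ∸ j))
  pull : ∀ s a b c d → s ℤ.* + (a ℕ.* b ℕ.* c) ℤ.* + d ≡ s ℤ.* + (d ℕ.* a ℕ.* (b ℕ.* c))
  pull s a b c d = trans (ℤP.*-assoc s (+ (a ℕ.* b ℕ.* c)) (+ d))
    (cong (ℤ._*_ s) (trans (sym (ℤP.pos-* (a ℕ.* b ℕ.* c) d)) (cong +_ (lemma a b c d))))
    where
    lemma : ∀ a b c d → a ℕ.* b ℕ.* c ℕ.* d ≡ d ℕ.* a ℕ.* (b ℕ.* c)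
    lemma = ℕSolver.solve-∀
  pull′ : ∀ s a b c d → s ℤ.* + (d ℕ.* a ℕ.* (b ℕ.* c)) ≡ + (a ℕ.* b) ℤ.* (s ℤ.* + c) ℤ.* + d
  pull′ s a b c d = begin
    s ℤ.* + (d ℕ.* a ℕ.* (b ℕ.* c))             ≡⟨ cong (λ x → s ℤ.* + x) (lemma a b c d) ⟩
    s ℤ.* + (a ℕ.* b ℕ.* c ℕ.* d)               ≡⟨ cong (ℤ._*_ s) (trans (ℤP.pos-* (a ℕ.* b ℕ.* c) d) (cong (ℤ._* + d) (ℤP.pos-* (a ℕ.* b) c))) ⟩
    s ℤ.* (+ (a ℕ.* b) ℤ.* + c ℤ.* + d)         ≡⟨ lemma′ s (+ (a ℕ.* b)) (+ c) (+ d) ⟩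
    + (a ℕ.* b) ℤ.* (s ℤ.* + c) ℤ.* + d         ∎
    where
    lemma : ∀ a b c d → d ℕ.* a ℕ.* (b ℕ.* c) ≡ a ℕ.* b ℕ.* c ℕ.* d
    lemma = ℕSolver.solve-∀
    lemma′ : ∀ s x y z → s ℤ.* (x ℤ.* y ℤ.* z) ≡ x ℤ.* (s ℤ.* y) ℤ.* z
    lemma′ = ℤSolver.solve-∀

theorem1 : ∀ (n m : ℕ) → 1 ≤ n →
    (+ count12312 n m) / 1 ≡ rhs n m
theorem1 (suc n) m _ = begin
  (+ count12312 (suc n) m) / 1
    ≡⟨ cong (λ c → (+ c) / 1) (count12312-paths (suc n) m) ⟩
  count / 1
    ≡⟨ /-cong count 0 (Σℤ≤ n (summand n m)) n
         (trans (ℤP.*-comm count (+ suc n)) (trans (path-count n m) (sym (ℤP.*-identityʳ (Σℤ≤ n (summand n m)))))) ⟩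
  Σℤ≤ n (summand n m) / suc n
    ≡⟨ sumℚ-/ n n terms (summand n m) (term-summand n m) ⟨
  sumℚ (applyUpTo terms (suc n))
    ≡⟨ cong sumℚ (map-upTo terms (suc n)) ⟨
  rhs (suc n) m ∎
  where
  count : ℤ
  count = staleCount (suc n) 0 m
  terms : ℕ → ℚ
  terms k = term (suc n) m (suc n ℕ.+ k)
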